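{- Let $P=C_2\times C_2\times C_2$ be the product of three two-element chains (with the componentwise order). Then the probability functions polytope $\mathcal{Q}_P\subset\mathbb{R}^{\mathcal{A}(P)}\cong\mathbb{R}^{18}$ has $77$ vertices, and exactly one of them does not have all coordinates in $\{0,1\}$, namely $\tfrac12\mathbf{1}$ (all coordinates equal to $\tfrac12$), which corresponds to the probability function $\mathrm{nu}$ with $\mathrm{nu}(x,y)=1$ if $x<y$, $\mathrm{nu}(x,y)=\tfrac12$ if $x\parallel y$, and $\mathrm{nu}(x,y)=0$ if $x>y$. Consequently $\mathcal{Q}_P$ is not a $0/1$-polytope and not a lattice polytope.
   Context: For $x,y$ in a poset $(P,\le)$, $x\parallel y$ means that neither $x\le y$ nor $y\le x$. A probability function on $P$ is a function $\pi:\{(x,y)\in P\times P\mid x\ne y\}\to[0,1]$ such that, for all $x,y,z\in P$ for which the values involved are defined: (1) $x\le y$ implies $\pi(x,y)=1$; (2) $x\neq y$ implies $\pi(x,y)+\pi(y,x)=1$; (3) $y<z$ implies $\pi(x,y)\le\pi(x,z)$; (4) $y<z$ implies $\pi(z,x)\le\pi(y,x)$. Put $\mathcal{A}(P)=\{(x,y)\in P\times P\mid x\parallel y\}$. The probability functions polytope $\mathcal{Q}_P\subset\mathbb{R}^{\mathcal{A}(P)}$ is the set of all restrictions $\pi|_{\mathcal{A}(P)}$ of probability functions $\pi$ on $P$; it is a convex polytope. A $0/1$-polytope is a polytope all of whose vertices have coordinates in $\{0,1\}$; a lattice polytope is one all of whose vertices have integer coordinates. -}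

module Defs where

open import Level using (Level; _⊔_; 0ℓ) renaming (suc to lsuc)
open import Algebra.Bundles using (CommutativeRing)
open import Algebra.Module.Bundles.Raw using (RawLeftModule)
import Algebra.Module.Construct.TensorUnit as TensorUnit
open import Algebra.Module.Morphism.Structures using (module LeftModuleMorphisms)
import Algebra.Properties.Monoid.Mult as Mult
import Algebra.Properties.Ring as RingProperties
open import Data.Fin.Base as Fin using (Fin)
import Data.Fin.Properties as Fin
open import Data.Integer.Base using (ℤ; +_; -[1+_])
open import Data.Irrelevant using ([_])
open import Data.Nat.Base using (suc)
open import Data.Product.Base using (_×_; _,_; ∃; ∃-syntax; Σ-syntax; proj₁; proj₂; uncurry)
open import Data.Product.Relation.Binary.Pointwise.NonDependent
  using (Pointwise; ×-isPartialOrder; ≡×≡⇒≡; ≡⇒≡×≡)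
open import Data.Refinement using (Refinement; Refinement-syntax; _,_)
open import Data.Sum.Base using (_⊎_; inj₁; inj₂)
open import Function.Base using (_∘_)
open import Function.Bundles using (_⇔_)
open import Relation.Binary.Bundles using (Setoid)
open import Relation.Binary.Core using (Rel)
import Relation.Binary.Construct.NonStrictToStrict as ToStrict
import Relation.Binary.Construct.On as On
open import Relation.Binary.PropositionalEquality using (_≡_; _≢_)
import Relation.Binary.PropositionalEquality as ≡
open import Relation.Binary.Structures using (IsPartialOrder; IsTotalOrder)
open import Relation.Nullary using (¬_)
open import Relation.Unary using (Pred)

-- The standard library has no real numbers, so the scalars range over all
-- (totally) ordered fields; classically ℝ is one.

record OrderedField c ℓ₁ ℓ₂ : Set (lsuc (c ⊔ ℓ₁ ⊔ ℓ₂)) where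
  infix 4 _≤_
  field
    commutativeRing : CommutativeRing c ℓ₁

  open CommutativeRing commutativeRing public

  field
    _≤_          : Rel Carrier ℓ₂
    isTotalOrder : IsTotalOrder _≈_ _≤_
    0≉1          : ¬ (0# ≈ 1#)
    invertible   : ∀ x → ¬ (x ≈ 0#) → ∃[ y ] x * y ≈ 1#
    +-monoʳ-≤    : ∀ x {y z} → y ≤ z → x + y ≤ x + z
    *-nonNeg     : ∀ {x y} → 0# ≤ x → 0# ≤ y → 0# ≤ x * y

  module ≤ = IsTotalOrder isTotalOrder

  0≤1 : 0# ≤ 1#
  0≤1 with ≤.total 0# 1#
  ... | inj₁ 0≤1′ = 0≤1′
  ... | inj₂ 1≤0  = ≤.≤-respʳ-≈ -1*-1≈1 (*-nonNeg 0≤-1 0≤-1)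
    where
    open RingProperties ring using (-‿distribˡ-*; -‿involutive)

    0≤-1 : 0# ≤ - 1#
    0≤-1 = ≤.≤-respˡ-≈ (-‿inverseˡ 1#)
             (≤.≤-respʳ-≈ (+-identityʳ (- 1#)) (+-monoʳ-≤ (- 1#) 1≤0))

    -1*-1≈1 : - 1# * - 1# ≈ 1#
    -1*-1≈1 = trans (sym (-‿distribˡ-* 1# (- 1#)))
                (trans (-‿cong (*-identityˡ (- 1#))) (-‿involutive 1#))

  2≉0 : ¬ (1# + 1# ≈ 0#)
  2≉0 2≈0 = 0≉1 (≤.antisym 0≤1 (≤.≤-respʳ-≈ 2≈0
              (≤.≤-respˡ-≈ (+-identityʳ 1#) (+-monoʳ-≤ 1# 0≤1))))

  ½ : Carrier
  ½ = proj₁ (invertible (1# + 1#) 2≉0)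

  open Mult +-monoid using () renaming (_×_ to _×′_)

  fromℤ : ℤ → Carrier
  fromℤ (+ n)    = n ×′ 1#
  fromℤ -[1+ n ] = - (suc n ×′ 1#)


-- Vertices of a subset of the vector space K^I of families indexed by I.

module Space {c ℓ₁ ℓ₂} (K : OrderedField c ℓ₁ ℓ₂) {i} (I : Set i) where
  open OrderedField K

  infix 4 _≋_

  Point : Set (i ⊔ c)
  Point = I → Carrier

  _≋_ : Rel Point (i ⊔ ℓ₁)
  v ≋ w = ∀ a → v a ≈ w a

  rawLeftModule : RawLeftModule Carrier (i ⊔ c) (i ⊔ ℓ₁)
  rawLeftModule = record
    { Carrierᴹ = Point
    ; _≈ᴹ_     = _≋_
    ; _+ᴹ_     = λ v w a → v a + w a
    ; _*ₗ_     = λ k v a → k * v a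
    ; 0ᴹ       = λ a → 0#
    ; -ᴹ_      = λ v a → - v a
    }

  pointSetoid : Setoid (i ⊔ c) (i ⊔ ℓ₁)
  pointSetoid = record
    { Carrier       = Point
    ; _≈_           = _≋_
    ; isEquivalence = record
      { refl  = λ a → refl
      ; sym   = λ p a → sym (p a)
      ; trans = λ p q a → trans (p a) (q a)
      }
    }

  IsLinear : (Point → Carrier) → Set (i ⊔ c ⊔ ℓ₁)
  IsLinear = IsLeftModuleHomomorphism
    where open LeftModuleMorphisms rawLeftModule (TensorUnit.rawLeftModule {R = rawRing})

  -- F = S ∩ { y ∣ φ y = k } for a linear inequality φ y ≤ k valid on S.
  IsFace : ∀ {s f} → Pred Point s → Pred Point f → Set (i ⊔ c ⊔ ℓ₁ ⊔ ℓ₂ ⊔ s ⊔ f)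
  IsFace S F = Σ[ φ ∈ (Point → Carrier) ] ∃[ k ]
    IsLinear φ × (∀ y → S y → φ y ≤ k) × (∀ y → F y ⇔ (S y × φ y ≈ k))

  -- A vertex is a zero-dimensional face, i.e. one consisting of a single point.
  IsVertex : ∀ {s} → Pred Point s → Pred Point (i ⊔ c ⊔ ℓ₁ ⊔ ℓ₂ ⊔ s)
  IsVertex S v = IsFace S (λ y → y ≋ v)

  vertexSetoid : ∀ {s} → Pred Point s → Setoid (i ⊔ c ⊔ ℓ₁ ⊔ ℓ₂ ⊔ s) (i ⊔ ℓ₁)
  vertexSetoid S = On.setoid {B = ∃ (IsVertex S)} pointSetoid proj₁

  ZeroOne : Pred Point (i ⊔ ℓ₁)
  ZeroOne v = ∀ a → v a ≈ 0# ⊎ v a ≈ 1#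

  Integral : Pred Point (i ⊔ ℓ₁)
  Integral v = ∀ a → ∃[ n ] v a ≈ fromℤ n

  -- These two are meant for sets S that are already known to be polytopes.
  IsZeroOnePolytope : ∀ {s} → Pred Point s → Set (i ⊔ c ⊔ ℓ₁ ⊔ ℓ₂ ⊔ s)
  IsZeroOnePolytope S = ∀ v → IsVertex S v → ZeroOne v

  IsLatticePolytope : ∀ {s} → Pred Point s → Set (i ⊔ c ⊔ ℓ₁ ⊔ ℓ₂ ⊔ s)
  IsLatticePolytope S = ∀ v → IsVertex S v → Integral v


module Incomparability {p q} {P : Set p} {_⊑_ : Rel P q}
                       (isPartialOrder : IsPartialOrder _≡_ _⊑_) where
  open IsPartialOrder isPartialOrder using (reflexive)
  open ToStrict _≡_ _⊑_ public using () renaming (_<_ to _⊏_)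

  infix 4 _∥_

  _∥_ : Rel P q
  x ∥ y = ¬ (x ⊑ y) × ¬ (y ⊑ x)

  ∥⇒≢ : ∀ {x y} → x ∥ y → x ≢ y
  ∥⇒≢ (x⋢y , _) x≡y = x⋢y (reflexive x≡y)

  -- The proof of incomparability is irrelevant, so that an element of 𝒜 is
  -- determined by its pair.
  𝒜 : Set (p ⊔ q)
  𝒜 = [ xy ∈ P × P ∣ uncurry _∥_ xy ]


module Probability {c ℓ₁ ℓ₂} (K : OrderedField c ℓ₁ ℓ₂)
                   {p q} {P : Set p} {_⊑_ : Rel P q}
                   (isPartialOrder : IsPartialOrder _≡_ _⊑_) where
  open OrderedField K
  open Incomparability isPartialOrder public
  open Space K 𝒜 public

  record ProbabilityFunction : Set (c ⊔ ℓ₁ ⊔ ℓ₂ ⊔ p ⊔ q) where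
    field
      π       : ∀ x y → .(x ≢ y) → Carrier
      0≤π     : ∀ {x y} .(x≢y : x ≢ y) → 0# ≤ π x y x≢y
      π≤1     : ∀ {x y} .(x≢y : x ≢ y) → π x y x≢y ≤ 1#
      ⊑⇒π≈1   : ∀ {x y} .(x≢y : x ≢ y) → x ⊑ y → π x y x≢y ≈ 1#
      π+π≈1   : ∀ {x y} .(x≢y : x ≢ y) .(y≢x : y ≢ x) → π x y x≢y + π y x y≢x ≈ 1#
      π-monoʳ : ∀ {x y z} .(x≢y : x ≢ y) .(x≢z : x ≢ z) →
                y ⊏ z → π x y x≢y ≤ π x z x≢z
      π-antiˡ : ∀ {x y z} .(z≢x : z ≢ x) .(y≢x : y ≢ x) →
                y ⊏ z → π z x z≢x ≤ π y x y≢x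

  open ProbabilityFunction public using (π)

  infix 4 _≈ₚ_

  _≈ₚ_ : Rel ProbabilityFunction (ℓ₁ ⊔ p)
  ρ ≈ₚ σ = ∀ x y .(x≢y : x ≢ y) → π ρ x y x≢y ≈ π σ x y x≢y

  restrict : ProbabilityFunction → Point
  restrict ρ ((x , y) , [ x∥y ]) = π ρ x y (∥⇒≢ x∥y)

  𝒬 : Pred Point (c ⊔ ℓ₁ ⊔ ℓ₂ ⊔ p ⊔ q)
  𝒬 v = ∃[ ρ ] restrict ρ ≋ v

  ½𝟏 : Point
  ½𝟏 _ = ½

  IsNu : Pred ProbabilityFunction (ℓ₁ ⊔ p ⊔ q)
  IsNu ρ = ∀ x y .(x≢y : x ≢ y) →
    (x ⊏ y → π ρ x y x≢y ≈ 1#) ×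
    (x ∥ y → π ρ x y x≢y ≈ ½) ×
    (y ⊏ x → π ρ x y x≢y ≈ 0#)


infixr 2 _×ᵖ_

_×ᵖ_ : ∀ {a b r s} {A : Set a} {B : Set b} {R : Rel A r} {S : Rel B s} →
       IsPartialOrder _≡_ R → IsPartialOrder _≡_ S →
       IsPartialOrder _≡_ (Pointwise R S)
_×ᵖ_ R-po S-po = record
  { isPreorder = record
    { isEquivalence = ≡.isEquivalence
    ; reflexive     = RS.reflexive ∘ ≡⇒≡×≡
    ; trans         = RS.trans
    }
  ; antisym = λ xy yx → ≡×≡⇒≡ (RS.antisym xy yx)
  }
  where module RS = IsPartialOrder (×-isPartialOrder R-po S-po)

C₂ : IsPartialOrder {A = Fin 2} _≡_ Fin._≤_
C₂ = Fin.≤-isPartialOrder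

{-# OPTIONS --safe #-}

-- Given thresholds θ x y in [0,1] with θ x y + θ y x = 1, the maps
-- u ↦ clamp(2u − θ, 0, 1) and u ↦ 2u − clamp(2u − θ, 0, 1) turn a probability
-- function π into two probability functions with midpoint π, provided that for
-- y < z either θ x y = θ x z or the constraint π x y ≤ π x z is made vacuous by
-- π x y = 0 or π x z = 1.  A vertex is not a proper midpoint, so each of its
-- coordinates is 0, 1 or θ x y.
--
-- The constant ½ is always admissible: vertices are half-integral.  Let e i be
-- the atoms of the cube and ē i their complements.  For the lexicographic order
-- in which coordinate i is in the middle position, the only non-vacuous
-- constraints along which θ jumps involve π (ē i) (e i); so if this value is 0,
-- the vertex is a 0/1 point.  Otherwise π (ē i) (e i) ≥ ½ for all i; these are
-- the minimal values of π on incomparable pairs, hence π is ½ on all of them.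
--
-- The 0/1 points of 𝒬 are vertices and there are 76 of them; ½𝟏 is the
-- only point of 𝒬 where Σᵢ π (ē i) (e i) attains its maximum 3/2.

module Submission where

open import Level using (Level; _⊔_)
import Algebra.Construct.NaturalChoice.Max as Max
import Algebra.Construct.NaturalChoice.Min as Min
import Algebra.Construct.NaturalChoice.MinMaxOp as MinMaxOp
open import Algebra.Definitions using (Congruent₁; Congruent₂)
import Algebra.Module.Construct.TensorUnit as TensorUnit
open import Algebra.Module.Morphism.Structures using (module LeftModuleMorphisms)
import Algebra.Properties.AbelianGroup as AbelianGroupProperties
import Algebra.Properties.CommutativeSemigroup as CommutativeSemigroupProperties
import Algebra.Properties.Monoid.Mult as Mult
import Algebra.Properties.Ring as RingProperties
import Algebra.Properties.Semiring.Sum as Sum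
import Algebra.Solver.Ring.NaturalCoefficients.Default as Solver
open import Data.Bool.Base as Bool using (Bool; true; false; not)
import Data.Bool.Properties as Bool
open import Data.Empty using (⊥-elim-irr)
open import Data.Fin.Base as Fin using (Fin; zero; suc)
open import Data.Fin.Patterns using (0F; 1F; 2F; 3F; 4F; 5F; 6F; 7F; 8F)
import Data.Fin.Properties as Fin
open import Data.Integer.Base using (+_; -[1+_])
open import Data.Irrelevant using ([_])
open import Data.List.Base as List
  using (List; []; _∷_; length; filter; cartesianProduct; cartesianProductWith; allFin)
open import Data.List.Membership.Propositional using (_∈_)
open import Data.List.Membership.Propositional.Properties
  using (∈-filter⁺; ∈-filter⁻; ∈-lookup; ∈-cartesianProduct⁺; ∈-cartesianProductWith⁺; ∈-allFin)
open import Data.List.Relation.Unary.All as All using ()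
open import Data.List.Relation.Unary.AllPairs using ([]; _∷_)
open import Data.List.Relation.Unary.Any as Any using (here; there)
open import Data.List.Relation.Unary.Any.Properties using (lookup-index)
open import Data.List.Relation.Unary.Unique.Propositional using (Unique)
import Data.List.Relation.Unary.Unique.Propositional.Properties as Unique
open import Data.Nat.Base as ℕ using (ℕ; zero; suc; _≤ᵇ_)
open import Data.Product.Base using (_×_; _,_; ∃; ∃-syntax; Σ-syntax; proj₁; proj₂; swap; uncurry)
open import Data.Product.Properties using () renaming (≡-dec to ×-≡-dec)
open import Data.Product.Relation.Binary.Pointwise.NonDependent using (Pointwise; ×-decidable)
open import Data.Refinement using (Refinement-syntax; _,_; value; value-injective)
open import Data.Sum.Base as ⊎ using (_⊎_; inj₁; inj₂; [_,_]′)
open import Data.Sum.Properties using () renaming (≡-dec to ⊎-≡-dec)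
open import Data.Vec.Base as Vec using (Vec; []; _∷_)
open import Data.Vec.Properties using (∷-injective; lookup∘tabulate; tabulate∘lookup; tabulate-cong)
open import Function.Base using (_∘_; id)
open import Function.Bundles using (Bijection; Equivalence; Inverse; _↔_; _⇔_; mk⇔; mk↔ₛ′)
open import Relation.Binary.Bundles using (TotalOrder)
open import Relation.Binary.Core using (Rel)
open import Relation.Binary.Definitions using (Decidable; DecidableEquality)
open import Relation.Binary.PropositionalEquality as ≡ using (_≡_; _≢_; setoid)
import Relation.Binary.Reasoning.PartialOrder as PosetReasoning
open import Relation.Binary.Structures using (IsPartialOrder)
open import Relation.Nullary using (¬_; Dec; yes; no; contradiction)
open import Relation.Nullary.Decidable
  using (map′; toWitness; recompute; ¬?; _→-dec_; _×-dec_; _⊎-dec_)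
open import Relation.Unary using (Pred) renaming (Decidable to Decidable₁)
open import Defs

-- Arithmetic in ordered fields.

module OrderedFieldProperties {c ℓ₁ ℓ₂} (K : OrderedField c ℓ₁ ℓ₂) where
  open OrderedField K hiding (zero)
  open AbelianGroupProperties +-abelianGroup
  open CommutativeSemigroupProperties +-commutativeSemigroup using (interchange)
  open Sum semiring using (sum)

  totalOrder : TotalOrder c ℓ₁ ℓ₂
  totalOrder = record { isTotalOrder = isTotalOrder }

  open TotalOrder totalOrder public using (poset)
  open PosetReasoning poset public
  open Min totalOrder using (minOperator; x≤y⇒x⊓y≈x)
  open Max totalOrder using (maxOperator; x≤y⇒x⊔y≈y)
  open Min totalOrder public using (_⊓_)
  open Max totalOrder public using () renaming (_⊔_ to _∨_)
  open MinMaxOp minOperator maxOperator public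

  ≤-refl : ∀ {x} → x ≤ x
  ≤-refl = ≤.reflexive refl

  +-monoˡ-≤ : ∀ x {y z} → y ≤ z → y + x ≤ z + x
  +-monoˡ-≤ x y≤z = ≤.≤-respˡ-≈ (+-comm x _) (≤.≤-respʳ-≈ (+-comm x _) (+-monoʳ-≤ x y≤z))

  +-mono-≤ : ∀ {w x y z} → w ≤ x → y ≤ z → w + y ≤ x + z
  +-mono-≤ {x = x} {y = y} w≤x y≤z = ≤.trans (+-monoˡ-≤ y w≤x) (+-monoʳ-≤ x y≤z)

  +-cancelʳ-≤ : ∀ {x y} z → x + z ≤ y + z → x ≤ y
  +-cancelʳ-≤ z x+z≤y+z = ≤.≤-respˡ-≈ (//-rightDividesʳ z _)
    (≤.≤-respʳ-≈ (//-rightDividesʳ z _) (+-monoˡ-≤ (- z) x+z≤y+z))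

  +-cancelʳ-≈ : ∀ {x y} z → x + z ≈ y + z → x ≈ y
  +-cancelʳ-≈ z x+z≈y+z = ≤.antisym (+-cancelʳ-≤ z (≤.reflexive x+z≈y+z))
                                    (+-cancelʳ-≤ z (≤.reflexive (sym x+z≈y+z)))

  -‿anti-≤ : ∀ x {y z} → y ≤ z → x - z ≤ x - y
  -‿anti-≤ x {y} {z} y≤z = +-cancelʳ-≤ z (begin
    x - z + z  ≈⟨ //-rightDividesˡ z x ⟩
    x          ≈⟨ //-rightDividesˡ y x ⟨
    x - y + y  ≤⟨ +-monoʳ-≤ (x - y) y≤z ⟩
    x - y + z  ∎)

  -- Halving without division: if `y ≤ x`, then `x + y ≤ x + x ≤ y + y`, and `y` cancels.
  x+x≤y+y⇒x≤y : ∀ {x y} → x + x ≤ y + y → x ≤ y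
  x+x≤y+y⇒x≤y {x} {y} x+x≤y+y with ≤.total x y
  ... | inj₁ x≤y = x≤y
  ... | inj₂ y≤x = +-cancelʳ-≤ y (≤.trans (+-monoʳ-≤ x y≤x) x+x≤y+y)

  -- The equality case of adding two inequalities. It turns maximality of a sum, or of a functional
  -- at a midpoint, into maximality of each summand.
  ≤∧≤∧+≈+⇒≈ : ∀ {w x y z} → w ≤ x → y ≤ z → w + y ≈ x + z → w ≈ x
  ≤∧≤∧+≈+⇒≈ {w} {x} {y} {z} w≤x y≤z eq = ≤.antisym w≤x (+-cancelʳ-≤ z (begin
    x + z  ≈⟨ eq ⟨
    w + y  ≤⟨ +-monoʳ-≤ w y≤z ⟩
    w + z  ∎))

  x+y≈z⇒y≈z-x : ∀ {x y z} → x + y ≈ z → y ≈ z - x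
  x+y≈z⇒y≈z-x {x} {y} {z} eq =
    +-cancelʳ-≈ x (trans (+-comm y x) (trans eq (sym (//-rightDividesˡ x z))))

  x+y≈1∧x≈1⇒y≈0 : ∀ {x y} → x + y ≈ 1# → x ≈ 1# → y ≈ 0#
  x+y≈1∧x≈1⇒y≈0 {x} {y} x+y≈1 x≈1 = +-cancelʳ-≈ x
    (trans (+-comm y x) (trans x+y≈1 (trans (sym x≈1) (sym (+-identityˡ x)))))

  x+y≈1∧x≈0⇒y≈1 : ∀ {x y} → x + y ≈ 1# → x ≈ 0# → y ≈ 1#
  x+y≈1∧x≈0⇒y≈1 {x} {y} x+y≈1 x≈0 = trans (sym (+-identityˡ y)) (trans (+-congʳ (sym x≈0)) x+y≈1)

  ½+½≈1 : ½ + ½ ≈ 1#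
  ½+½≈1 = begin-equality
    ½ + ½              ≈⟨ +-cong (*-identityˡ ½) (*-identityˡ ½) ⟨
    1# * ½ + 1# * ½    ≈⟨ distribʳ ½ 1# 1# ⟨
    (1# + 1#) * ½      ≈⟨ proj₂ (invertible (1# + 1#) 2≉0) ⟩
    1#                 ∎

  0≤½ : 0# ≤ ½
  0≤½ = x+x≤y+y⇒x≤y (≤.≤-respˡ-≈ (sym (+-identityˡ 0#)) (≤.≤-respʳ-≈ (sym ½+½≈1) 0≤1))

  ½≤1 : ½ ≤ 1#
  ½≤1 = ≤.≤-respˡ-≈ (+-identityʳ ½) (≤.≤-respʳ-≈ ½+½≈1 (+-monoʳ-≤ ½ 0≤½))

  ½≉0 : ¬ ½ ≈ 0#
  ½≉0 ½≈0 = 0≉1 (trans (sym (+-identityˡ 0#)) (trans (sym (+-cong ½≈0 ½≈0)) ½+½≈1))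

  ½≉1 : ¬ ½ ≈ 1#
  ½≉1 ½≈1 = ½≉0 (x+y≈1∧x≈1⇒y≈0 ½+½≈1 ½≈1)

  open Mult +-monoid using () renaming (_×_ to _×′_)

  0≤n×1 : ∀ n → 0# ≤ n ×′ 1#
  0≤n×1 zero    = ≤-refl
  0≤n×1 (suc n) = ≤.≤-respˡ-≈ (+-identityˡ 0#) (+-mono-≤ 0≤1 (0≤n×1 n))

  1≤[1+n]×1 : ∀ n → 1# ≤ suc n ×′ 1#
  1≤[1+n]×1 n = ≤.≤-respˡ-≈ (+-identityʳ 1#) (+-monoʳ-≤ 1# (0≤n×1 n))

  -- The image of an integer is at most 0 or at least 1, and `½` lies strictly between.
  ½-nonInteger : ∀ n → ¬ ½ ≈ fromℤ n
  ½-nonInteger (+ zero)  ½≈n = ½≉0 ½≈n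
  ½-nonInteger (+ suc n) ½≈n = ½≉1 (≤.antisym ½≤1 (≤.≤-respʳ-≈ (sym ½≈n) (1≤[1+n]×1 n)))
  ½-nonInteger -[1+ n ]  ½≈n = ½≉0 (≤.antisym (begin
    ½                      ≈⟨ ½≈n ⟩
    - (suc n ×′ 1#)        ≈⟨ +-identityˡ _ ⟨
    0# - (suc n ×′ 1#)     ≤⟨ -‿anti-≤ 0# (0≤n×1 (suc n)) ⟩
    0# - 0#                ≈⟨ -‿inverseʳ 0# ⟩
    0#                     ∎) 0≤½)

  -- Truth values as scalars, and equality in sums of inequalities.

  fromBool : Bool → Carrier
  fromBool false = 0#
  fromBool true  = 1#

  fromBool-0≤ : ∀ b → 0# ≤ fromBool b
  fromBool-0≤ false = ≤-refl
  fromBool-0≤ true  = 0≤1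

  fromBool-≤1 : ∀ b → fromBool b ≤ 1#
  fromBool-≤1 false = 0≤1
  fromBool-≤1 true  = ≤-refl

  fromBool-mono-≤ : ∀ {b d} → b Bool.≤ d → fromBool b ≤ fromBool d
  fromBool-mono-≤ Bool.f≤t = 0≤1
  fromBool-mono-≤ Bool.b≤b = ≤-refl

  fromBool-cancel-≤ : ∀ b d → fromBool b ≤ fromBool d → b Bool.≤ d
  fromBool-cancel-≤ false false _   = Bool.b≤b
  fromBool-cancel-≤ false true  _   = Bool.f≤t
  fromBool-cancel-≤ true  true  _   = Bool.b≤b
  fromBool-cancel-≤ true  false 1≤0 = contradiction (≤.antisym 0≤1 1≤0) 0≉1

  fromBool-injective : ∀ b d → fromBool b ≈ fromBool d → b ≡ d
  fromBool-injective false false _   = ≡.refl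
  fromBool-injective true  true  _   = ≡.refl
  fromBool-injective false true  0≈1 = contradiction 0≈1 0≉1
  fromBool-injective true  false 1≈0 = contradiction (sym 1≈0) 0≉1

  fromBool-not : ∀ b → fromBool b + fromBool (not b) ≈ 1#
  fromBool-not false = +-identityˡ 1#
  fromBool-not true  = +-identityʳ 1#

  0or1⇒fromBool : ∀ {x} → x ≈ 0# ⊎ x ≈ 1# → ∃[ b ] fromBool b ≈ x
  0or1⇒fromBool (inj₁ x≈0) = false , sym x≈0
  0or1⇒fromBool (inj₂ x≈1) = true  , sym x≈1

  fromBool-0or1 : ∀ b → fromBool b ≈ 0# ⊎ fromBool b ≈ 1#
  fromBool-0or1 false = inj₁ refl
  fromBool-0or1 true  = inj₂ refl

  sum-mono-≤ : ∀ {n} {f g : Fin n → Carrier} → (∀ i → f i ≤ g i) → sum f ≤ sum g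
  sum-mono-≤ {zero}  f≤g = ≤-refl
  sum-mono-≤ {suc n} f≤g = +-mono-≤ (f≤g zero) (sum-mono-≤ (f≤g ∘ suc))

  ≤∧sum≈⇒≈ : ∀ {n} {f g : Fin n → Carrier} → (∀ i → f i ≤ g i) → sum f ≈ sum g →
             ∀ i → f i ≈ g i
  ≤∧sum≈⇒≈ f≤g eq zero    = ≤∧≤∧+≈+⇒≈ (f≤g zero) (sum-mono-≤ (f≤g ∘ suc)) eq
  -- With head and tail exchanged, the same equality case shows that the two tails have equal sums.
  ≤∧sum≈⇒≈ f≤g eq (suc i) = ≤∧sum≈⇒≈ (f≤g ∘ suc)
    (≤∧≤∧+≈+⇒≈ (sum-mono-≤ (f≤g ∘ suc)) (f≤g zero)
      (trans (+-comm _ _) (trans eq (+-comm _ _)))) i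

  -- The two rescalings whose average is the identity.

  -- `coclamp t x` equals `x + x - clamp t x`; the form with minimum and maximum makes its
  -- monotonicity in `x` visible, which the difference hides.
  clamp coclamp : Carrier → Carrier → Carrier
  clamp   t x = 0# ∨ (1# ⊓ (x + x - t))
  coclamp t x = (x + x) ⊓ ((x + x - 1#) ∨ t)

  -- Subtraction from `x` reverses the order and therefore exchanges minimum and maximum.
  -‿distrib-clamp : ∀ x y → x - (0# ∨ (1# ⊓ y)) ≈ x ⊓ ((x - 1#) ∨ (x - y))
  -‿distrib-clamp x y = begin-equality
    x - (0# ∨ (1# ⊓ y))           ≈⟨ antimono-≤-distrib-⊔ x-cong (-‿anti-≤ x) 0# (1# ⊓ y) ⟩
    (x - 0#) ⊓ (x - (1# ⊓ y))     ≈⟨ ⊓-cong x-0≈x (antimono-≤-distrib-⊓ x-cong (-‿anti-≤ x) 1# y) ⟩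
    x ⊓ ((x - 1#) ∨ (x - y))      ∎
    where
    x-cong : Congruent₁ _≈_ (λ y → x - y)
    x-cong = +-congˡ ∘ -‿cong

    x-0≈x : x - 0# ≈ x
    x-0≈x = trans (+-congˡ ε⁻¹≈ε) (+-identityʳ x)

  clamp+coclamp : ∀ t x → clamp t x + coclamp t x ≈ x + x
  clamp+coclamp t x = begin-equality
    clamp t x + coclamp t x          ≈⟨ +-congˡ (⊓-congˡ (x + x) (⊔-congˡ (x + x - 1#) (x+y≈z⇒y≈z-x (//-rightDividesˡ t (x + x))))) ⟩
    clamp t x + ((x + x) ⊓ ((x + x - 1#) ∨ (x + x - (x + x - t))))
                                     ≈⟨ +-congˡ (-‿distrib-clamp (x + x) (x + x - t)) ⟨
    clamp t x + (x + x - clamp t x)  ≈⟨ +-comm _ _ ⟩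
    x + x - clamp t x + clamp t x    ≈⟨ //-rightDividesˡ _ (x + x) ⟩
    x + x                            ∎

  -- The truncated arguments `u` and `u′` add up to 1, and reflection in ½ maps the interval from 0
  -- to 1 to itself, so it commutes with truncation.
  clamp-complement : ∀ {t t′ x x′} → t + t′ ≈ 1# → x + x′ ≈ 1# → clamp t x + clamp t′ x′ ≈ 1#
  clamp-complement {t} {t′} {x} {x′} t+t′≈1 x+x′≈1 = begin-equality
    clamp t x + clamp t′ x′          ≈⟨ +-congˡ (⊔-congˡ 0# (⊓-congˡ 1# u′≈1-u)) ⟩
    clamp t x + (0# ∨ (1# ⊓ (1# - u)))
                                     ≈⟨ +-congˡ swap-bounds ⟩
    clamp t x + (1# ⊓ ((1# - 1#) ∨ (1# - u)))
                                     ≈⟨ +-congˡ (-‿distrib-clamp 1# u) ⟨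
    clamp t x + (1# - clamp t x)     ≈⟨ +-comm _ _ ⟩
    1# - clamp t x + clamp t x       ≈⟨ //-rightDividesˡ _ 1# ⟩
    1#                               ∎
    where
    u  = x + x - t
    u′ = x′ + x′ - t′

    u+u′≈1 : u + u′ ≈ 1#
    u+u′≈1 = +-cancelʳ-≈ 1# (begin-equality
      u + u′ + 1#                ≈⟨ +-congˡ t+t′≈1 ⟨
      u + u′ + (t + t′)          ≈⟨ interchange u u′ t t′ ⟩
      (u + t) + (u′ + t′)        ≈⟨ +-cong (//-rightDividesˡ t _) (//-rightDividesˡ t′ _) ⟩
      (x + x) + (x′ + x′)        ≈⟨ interchange x x x′ x′ ⟩
      (x + x′) + (x + x′)        ≈⟨ +-cong x+x′≈1 x+x′≈1 ⟩
      1# + 1#                    ∎)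

    u′≈1-u : u′ ≈ 1# - u
    u′≈1-u = x+y≈z⇒y≈z-x u+u′≈1

    -- Since `0# ≤ 1#`, truncating first below or first above gives the same result.
    swap-bounds : 0# ∨ (1# ⊓ (1# - u)) ≈ 1# ⊓ ((1# - 1#) ∨ (1# - u))
    swap-bounds = begin-equality
      0# ∨ (1# ⊓ (1# - u))           ≈⟨ ⊔-distribˡ-⊓ 0# 1# (1# - u) ⟩
      (0# ∨ 1#) ⊓ (0# ∨ (1# - u))    ≈⟨ ⊓-cong (x≤y⇒x⊔y≈y 0≤1) (⊔-congʳ (1# - u) (sym (-‿inverseʳ 1#))) ⟩
      1# ⊓ ((1# - 1#) ∨ (1# - u))    ∎

  -- All four rescaled values add up to 2, and the two `clamp` values account for 1 of it.
  coclamp-complement : ∀ {t t′ x x′} → t + t′ ≈ 1# → x + x′ ≈ 1# → coclamp t x + coclamp t′ x′ ≈ 1#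
  coclamp-complement {t} {t′} {x} {x′} t+t′≈1 x+x′≈1 = +-cancelʳ-≈ 1# (begin-equality
    coclamp t x + coclamp t′ x′ + 1#     ≈⟨ +-congˡ (clamp-complement t+t′≈1 x+x′≈1) ⟨
    coclamp t x + coclamp t′ x′ + (clamp t x + clamp t′ x′)
                                         ≈⟨ trans (+-comm _ _) (interchange _ _ _ _) ⟩
    (clamp t x + coclamp t x) + (clamp t′ x′ + coclamp t′ x′)
                                         ≈⟨ +-cong (clamp+coclamp t x) (clamp+coclamp t′ x′) ⟩
    (x + x) + (x′ + x′)                  ≈⟨ interchange x x x′ x′ ⟩
    (x + x′) + (x + x′)                  ≈⟨ +-cong x+x′≈1 x+x′≈1 ⟩
    1# + 1#                              ∎)

  -- Truncation returns a bound or `x + x - t` itself; in the last case `x + x - t ≈ x` gives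
  -- `x ≈ t`.
  clamp-fixed : ∀ {t x} → clamp t x ≈ x → x ≈ 0# ⊎ x ≈ 1# ⊎ x ≈ t
  clamp-fixed {t} {x} fixed with ⊔-sel 0# (1# ⊓ (x + x - t))
  ... | inj₁ ≈0 = inj₁ (trans (sym fixed) ≈0)
  ... | inj₂ ≈⊓ with ⊓-sel 1# (x + x - t)
  ...   | inj₁ ≈1 = inj₂ (inj₁ (trans (sym fixed) (trans ≈⊓ ≈1)))
  ...   | inj₂ ≈- = inj₂ (inj₂ (+-cancelʳ-≈ x (begin-equality
    x + x          ≈⟨ //-rightDividesˡ t (x + x) ⟨
    x + x - t + t  ≈⟨ +-congʳ (trans (sym ≈-) (trans (sym ≈⊓) fixed)) ⟩
    x + t          ≈⟨ +-comm x t ⟩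
    t + x          ∎)))

  -- Collects what is used to apply `f` with suitable thresholds to every value of a probability
  -- function and obtain a probability function again, so that `clamp` and `coclamp` are treated
  -- together.
  record IsRescaling (f : Carrier → Carrier → Carrier) : Set (c ⊔ ℓ₁ ⊔ ℓ₂) where
    field
      nonNeg      : ∀ {t x} → 0# ≤ t → 0# ≤ x → 0# ≤ f t x
      cong        : Congruent₂ _≈_ f
      monoʳ       : ∀ t {x y} → x ≤ y → f t x ≤ f t y
      one         : ∀ {t} → 0# ≤ t → t ≤ 1# → f t 1# ≈ 1#
      f+f≈1       : ∀ {t t′ x x′} → t + t′ ≈ 1# → x + x′ ≈ 1# → f t x + f t′ x′ ≈ 1#

    ≤1 : ∀ {t x} → 0# ≤ t → t ≤ 1# → x ≤ 1# → f t x ≤ 1#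
    ≤1 {t} 0≤t t≤1 x≤1 = ≤.≤-respʳ-≈ (one 0≤t t≤1) (monoʳ t x≤1)

  clamp-one : ∀ {t} → t ≤ 1# → clamp t 1# ≈ 1#
  clamp-one {t} t≤1 = begin-equality
    0# ∨ (1# ⊓ (1# + 1# - t))  ≈⟨ ⊔-congˡ 0# (x≤y⇒x⊓y≈x 1≤2-t) ⟩
    0# ∨ 1#                    ≈⟨ x≤y⇒x⊔y≈y 0≤1 ⟩
    1#                         ∎
    where
    1≤2-t : 1# ≤ 1# + 1# - t
    1≤2-t = begin
      1#            ≈⟨ //-rightDividesʳ 1# 1# ⟨
      1# + 1# - 1#  ≤⟨ -‿anti-≤ (1# + 1#) t≤1 ⟩
      1# + 1# - t   ∎

  clamp-isRescaling : IsRescaling clamp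
  clamp-isRescaling = record
    { nonNeg = λ _ _ → x≤x⊔y 0# _
    ; cong   = λ t≈ x≈ → ⊔-congˡ 0# (⊓-congˡ 1# (+-cong (+-cong x≈ x≈) (-‿cong t≈)))
    ; monoʳ  = λ t x≤y → ⊔-monoʳ-≤ 0# (⊓-monoʳ-≤ 1# (+-monoˡ-≤ (- t) (+-mono-≤ x≤y x≤y)))
    ; one    = λ _ → clamp-one
    ; f+f≈1  = clamp-complement
    }

  coclamp-isRescaling : IsRescaling coclamp
  coclamp-isRescaling = record
    { nonNeg = λ {t} {x} 0≤t 0≤x → ⊓-glb (≤.≤-respˡ-≈ (+-identityˡ 0#) (+-mono-≤ 0≤x 0≤x))
                                         (≤.trans 0≤t (x≤y⊔x _ t))
    ; cong   = λ t≈ x≈ → ⊓-cong (+-cong x≈ x≈) (⊔-cong (+-congʳ (+-cong x≈ x≈)) t≈)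
    ; monoʳ  = λ t x≤y → ⊓-mono-≤ (+-mono-≤ x≤y x≤y)
                                  (⊔-monoˡ-≤ t (+-monoˡ-≤ (- 1#) (+-mono-≤ x≤y x≤y)))
    -- At `1#` the two maps add up to `1# + 1#`, and `clamp` contributes `1#`.
    ; one    = λ {t} _ t≤1 → +-cancelʳ-≈ 1# (trans (+-comm _ 1#)
                 (trans (+-congʳ (sym (clamp-one t≤1))) (clamp+coclamp t 1#)))
    ; f+f≈1  = coclamp-complement
    }

-- Vertices and linear functionals.

module SpaceProperties {c ℓ₁ ℓ₂} (K : OrderedField c ℓ₁ ℓ₂) {i} (I : Set i) where
  open OrderedField K hiding (zero)
  open OrderedFieldProperties K
  open RingProperties ring using (-1*x≈-x)
  open Space K I
  open Sum semiring
  open CommutativeSemigroupProperties *-commutativeSemigroup using (x∙yz≈y∙xz)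

  vertex∈ : ∀ {s} {S : Pred Point s} {v} → IsVertex S v → S v
  vertex∈ {v = v} (_ , _ , _ , _ , face) = proj₁ (Equivalence.to (face v) (λ _ → refl))

  -- The functional exposing `v` is at most `k` at `u` and at `w`, while these two values add up to
  -- `k + k`. Both are therefore `k`, so `u` lies on the face consisting of `v` alone.
  vertex-extreme : ∀ {s} {S : Pred Point s} {u v w} → IsVertex S v → S u → S w →
                   (∀ a → u a + w a ≈ v a + v a) → u ≋ v
  vertex-extreme {u = u} {v} {w} (φ , k , linear , φ≤k , face) u∈S w∈S u+w≈v+v =
    Equivalence.from (face u) (u∈S , ≤∧≤∧+≈+⇒≈ (φ≤k u u∈S) (φ≤k w w∈S) (begin-equality
      φ u + φ w                ≈⟨ φ.+ᴹ-homo u w ⟨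
      φ (λ a → u a + w a)      ≈⟨ φ.⟦⟧-cong u+w≈v+v ⟩
      φ (λ a → v a + v a)      ≈⟨ φ.+ᴹ-homo v v ⟩
      φ v + φ v                ≈⟨ +-cong φv≈k φv≈k ⟩
      k + k                    ∎))
    where
    open LeftModuleMorphisms rawLeftModule (TensorUnit.rawLeftModule {R = rawRing})
    module φ = IsLeftModuleHomomorphism linear

    φv≈k : φ v ≈ k
    φv≈k = proj₂ (Equivalence.to (face v) (λ _ → refl))

  weightedSum-isLinear : ∀ {n} (s : Fin n → Carrier) (a : Fin n → I) →
                         IsLinear (λ y → sum λ i → s i * y (a i))
  weightedSum-isLinear s a = record
    { +ᴹ-isGroupHomomorphism = record
      { isMonoidHomomorphism = record
        { isMagmaHomomorphism = record
          { isRelHomomorphism = record { cong = φ-cong }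
          ; homo = λ y z → trans (sum-cong-≋ λ i → distribˡ (s i) (y (a i)) (z (a i)))
                                 (∑-distrib-+ (λ i → s i * y (a i)) (λ i → s i * z (a i)))
          }
        -- Zero and negation are handled as multiplication by the scalars `0#` and `- 1#`.
        ; ε-homo = trans (φ-cong λ _ → sym (zeroˡ 0#)) (trans (φ-* 0# (λ _ → 0#)) (zeroˡ _))
        }
      ; ⁻¹-homo = λ y → trans (φ-cong λ b → sym (-1*x≈-x (y b))) (trans (φ-* (- 1#) y) (-1*x≈-x _))
      }
    ; *ₗ-homo = φ-*
    }
    where
    φ : Point → Carrier
    φ y = sum λ i → s i * y (a i)

    φ-cong : ∀ {y z} → y ≋ z → φ y ≈ φ z
    φ-cong y≋z = sum-cong-≋ λ i → *-congˡ (y≋z (a i))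

    φ-* : ∀ k y → φ (λ b → k * y b) ≈ k * φ y
    φ-* k y = trans (sum-cong-≋ λ i → x∙yz≈y∙xz (s i) k (y (a i)))
                      (sym (*-distribˡ-sum k λ i → s i * y (a i)))

-- Probability functions on an arbitrary poset.

module ProbabilityProperties {c ℓ₁ ℓ₂} (K : OrderedField c ℓ₁ ℓ₂) {p q} {P : Set p} {_⊑_ : Rel P q}
                             (isPartialOrder : IsPartialOrder _≡_ _⊑_) where
  open OrderedField K hiding (zero)
  open OrderedFieldProperties K
  open IsPartialOrder isPartialOrder using (antisym) renaming (trans to ⊑-trans)
  open Probability K isPartialOrder
  open SpaceProperties K 𝒜 public
  open Sum semiring using (sum; sum-cong-≋)

  complement-anti : ∀ {x x′ y y′} → x + x′ ≈ 1# → y + y′ ≈ 1# → x ≤ y → y′ ≤ x′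
  complement-anti {x} {x′} {y} {y′} x+x′≈1 y+y′≈1 x≤y = +-cancelʳ-≤ x (begin
    y′ + x  ≤⟨ +-monoʳ-≤ y′ x≤y ⟩
    y′ + y  ≈⟨ trans (+-comm y′ y) y+y′≈1 ⟩
    1#      ≈⟨ trans (+-comm x′ x) x+x′≈1 ⟨
    x′ + x  ∎)

  record ProbabilityFunctionʳ : Set (c ⊔ ℓ₁ ⊔ ℓ₂ ⊔ p ⊔ q) where
    field
      μ       : ∀ x y → .(x ≢ y) → Carrier
      0≤μ     : ∀ {x y} .(x≢y : x ≢ y) → 0# ≤ μ x y x≢y
      ⊑⇒μ≈1   : ∀ {x y} .(x≢y : x ≢ y) → x ⊑ y → μ x y x≢y ≈ 1#
      μ+μ≈1   : ∀ {x y} .(x≢y : x ≢ y) .(y≢x : y ≢ x) → μ x y x≢y + μ y x y≢x ≈ 1#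
      μ-monoʳ : ∀ {x y z} .(x≢y : x ≢ y) .(x≢z : x ≢ z) → y ⊏ z → μ x y x≢y ≤ μ x z x≢z

  -- Complementation turns nonnegativity into the upper bound 1, and monotonicity in the second
  -- argument into antitonicity in the first.
  fromʳ : ProbabilityFunctionʳ → ProbabilityFunction
  fromʳ σ = record
    { π       = μ
    ; 0≤π     = 0≤μ
    ; π≤1     = λ x≢y → begin
        μ _ _ x≢y                      ≈⟨ +-identityʳ _ ⟨
        μ _ _ x≢y + 0#                 ≤⟨ +-monoʳ-≤ _ (0≤μ (≡.≢-sym x≢y)) ⟩
        μ _ _ x≢y + μ _ _ (≡.≢-sym x≢y) ≈⟨ μ+μ≈1 x≢y (≡.≢-sym x≢y) ⟩
        1#                             ∎
    ; ⊑⇒π≈1   = ⊑⇒μ≈1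
    ; π+π≈1   = μ+μ≈1
    ; π-monoʳ = μ-monoʳ
    ; π-antiˡ = λ z≢x y≢x y⊏z → complement-anti
        (μ+μ≈1 (≡.≢-sym y≢x) y≢x) (μ+μ≈1 (≡.≢-sym z≢x) z≢x) (μ-monoʳ _ _ y⊏z)
    }
    where open ProbabilityFunctionʳ σ

  open ProbabilityFunction hiding (π)

  ⊒⇒π≈0 : ∀ ρ {x y} .(x≢y : x ≢ y) → y ⊑ x → π ρ x y x≢y ≈ 0#
  ⊒⇒π≈0 ρ x≢y y⊑x =
    x+y≈1∧x≈1⇒y≈0 (π+π≈1 ρ (≡.≢-sym x≢y) x≢y) (⊑⇒π≈1 ρ (≡.≢-sym x≢y) y⊑x)

  -- Rescaling a probability function by thresholds.

  record Thresholds (ρ : ProbabilityFunction) : Set (c ⊔ ℓ₁ ⊔ ℓ₂ ⊔ p ⊔ q) where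
    field
      θ       : P → P → Carrier
      0≤θ     : ∀ x y → 0# ≤ θ x y
      θ≤1     : ∀ x y → θ x y ≤ 1#
      θ+θ≈1   : ∀ {x y} → .(x ≢ y) → θ x y + θ y x ≈ 1#
      θ-const : ∀ {x y z} .(x≢y : x ≢ y) .(x≢z : x ≢ z) → y ⊏ z →
                θ x y ≈ θ x z ⊎ π ρ x y x≢y ≈ 0# ⊎ π ρ x z x≢z ≈ 1#

  module _ {ρ : ProbabilityFunction} (thresholds : Thresholds ρ) where
    open Thresholds thresholds

    rescale : ∀ {f} → IsRescaling f → ProbabilityFunction
    rescale {f} isRescaling = fromʳ record
      { μ       = μ
      ; 0≤μ     = 0≤μ
      ; ⊑⇒μ≈1   = λ x≢y x⊑y → ≈1 x≢y (⊑⇒π≈1 ρ x≢y x⊑y)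
      ; μ+μ≈1   = μ+μ≈1
      ; μ-monoʳ = mono
      }
      where
      open IsRescaling isRescaling

      μ : ∀ x y → .(x ≢ y) → Carrier
      μ x y x≢y = f (θ x y) (π ρ x y x≢y)

      0≤μ : ∀ {x y} .(x≢y : x ≢ y) → 0# ≤ μ x y x≢y
      0≤μ x≢y = nonNeg (0≤θ _ _) (0≤π ρ x≢y)

      ≈1 : ∀ {x y} .(x≢y : x ≢ y) → π ρ x y x≢y ≈ 1# → μ x y x≢y ≈ 1#
      ≈1 x≢y π≈1 = trans (cong refl π≈1) (one (0≤θ _ _) (θ≤1 _ _))

      μ+μ≈1 : ∀ {x y} .(x≢y : x ≢ y) .(y≢x : y ≢ x) → μ x y x≢y + μ y x y≢x ≈ 1#
      μ+μ≈1 x≢y y≢x = f+f≈1 (θ+θ≈1 x≢y) (π+π≈1 ρ x≢y y≢x)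

      ≈0 : ∀ {x y} .(x≢y : x ≢ y) → π ρ x y x≢y ≈ 0# → μ x y x≢y ≈ 0#
      ≈0 x≢y π≈0 = x+y≈1∧x≈1⇒y≈0 (μ+μ≈1 (≡.≢-sym x≢y) x≢y)
        (≈1 (≡.≢-sym x≢y) (x+y≈1∧x≈0⇒y≈1 (π+π≈1 ρ x≢y (≡.≢-sym x≢y)) π≈0))

      mono : ∀ {x y z} .(x≢y : x ≢ y) .(x≢z : x ≢ z) → y ⊏ z → μ x y x≢y ≤ μ x z x≢z
      mono {x} {y} {z} x≢y x≢z y⊏z with θ-const x≢y x≢z y⊏z
      ... | inj₁ θ≈θ = begin
        μ x y x≢y                 ≤⟨ monoʳ (θ x y) (π-monoʳ ρ x≢y x≢z y⊏z) ⟩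
        f (θ x y) (π ρ x z x≢z)   ≈⟨ cong θ≈θ refl ⟩
        μ x z x≢z                 ∎
      -- Here the threshold may jump, but the values 0 and 1 are preserved for every threshold, so
      -- the inequality reduces to a bound by 0 or 1.
      ... | inj₂ (inj₁ π≈0) = ≤.≤-respˡ-≈ (sym (≈0 x≢y π≈0)) (0≤μ x≢z)
      ... | inj₂ (inj₂ π≈1) = ≤.≤-respʳ-≈ (sym (≈1 x≢z π≈1)) (≤1 (0≤θ x y) (θ≤1 x y) (π≤1 ρ x≢y))

    -- The vertex is the midpoint of its images under clamp and coclamp.
    vertex-values : ∀ {v} → IsVertex 𝒬 v → restrict ρ ≋ v →
                    ∀ a → v a ≈ 0# ⊎ v a ≈ 1# ⊎ v a ≈ θ (proj₁ (value a)) (proj₂ (value a))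
    vertex-values {v} vertex ρ≋v a@((x , y) , [ x∥y ]) = clamp-fixed
      (trans (IsRescaling.cong clamp-isRescaling refl (sym (ρ≋v a)))
        (vertex-extreme vertex (rescale clamp-isRescaling , λ _ → refl)
                               (rescale coclamp-isRescaling , λ _ → refl)
          (λ b → trans (clamp+coclamp _ _) (+-cong (ρ≋v b) (ρ≋v b))) a))

  -- Complementary coordinates and 0/1 points.

  flip : 𝒜 → 𝒜
  flip ((x , y) , [ x∥y ]) = (y , x) , [ swap x∥y ]

  𝒬-≤1 : ∀ {v} → 𝒬 v → ∀ a → v a ≤ 1#
  𝒬-≤1 (ρ , ρ≋v) a@(_ , [ x∥y ]) = ≤.≤-respˡ-≈ (ρ≋v a) (π≤1 ρ (∥⇒≢ x∥y))

  𝒬-flip : ∀ {v} → 𝒬 v → ∀ a → v a + v (flip a) ≈ 1#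
  𝒬-flip (ρ , ρ≋v) a@(_ , [ x∥y ]) = trans (+-cong (sym (ρ≋v a)) (sym (ρ≋v (flip a))))
    (π+π≈1 ρ (∥⇒≢ x∥y) (∥⇒≢ (swap x∥y)))

  -- A coordinate and its flip add up to 1, so neither can exceed `½` when both are at least `½`.
  ½≤⇒≋½𝟏 : ∀ {v} → 𝒬 v → (∀ a → ½ ≤ v a) → v ≋ ½𝟏
  ½≤⇒≋½𝟏 v∈𝒬 ½≤v a = sym (≤∧≤∧+≈+⇒≈ (½≤v a) (½≤v (flip a)) (trans ½+½≈1 (sym (𝒬-flip v∈𝒬 a))))

  -- A 0/1 point v is the only point of 𝒬 at which the functional y ↦ Σ v a * y a
  -- is maximal: it forces y a ≈ 1 where v a ≈ 1, and by complementation y a ≈ 0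
  -- where v a ≈ 0.
  zeroOne⇒vertex : ∀ {n} → 𝒜 ↔ Fin n → ∀ {v} → 𝒬 v → ZeroOne v → IsVertex 𝒬 v
  zeroOne⇒vertex {n} 𝒜↔Fin {v} v∈𝒬@(ρ , ρ≋v) zeroOne =
    φ , φ v , weightedSum-isLinear (v ∘ from) from ,
    (λ y y∈𝒬 → sum-mono-≤ (vy≤vv y∈𝒬 ∘ from)) ,
    (λ y → mk⇔ (λ y≋v → (ρ , λ a → trans (ρ≋v a) (sym (y≋v a))) ,
                        sum-cong-≋ λ i → *-congˡ (y≋v (from i)))
               (λ (y∈𝒬 , φy≈φv) → maximal y∈𝒬 φy≈φv))
    where
    open Inverse 𝒜↔Fin using (to; from; strictlyInverseʳ)

    φ : Point → Carrier
    φ y = sum λ i → v (from i) * y (from i)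

    v*-≈0 : ∀ {y : Point} a → v a ≈ 0# → v a * y a ≈ 0#
    v*-≈0 a va≈0 = trans (*-congʳ va≈0) (zeroˡ _)

    v*-≈1 : ∀ {y : Point} a → v a ≈ 1# → v a * y a ≈ y a
    v*-≈1 a va≈1 = trans (*-congʳ va≈1) (*-identityˡ _)

    vy≤vv : ∀ {y} → 𝒬 y → ∀ a → v a * y a ≤ v a * v a
    vy≤vv {y} y∈𝒬 a with zeroOne a
    ... | inj₁ va≈0 = ≤.reflexive (trans (v*-≈0 {y} a va≈0) (sym (v*-≈0 {v} a va≈0)))
    ... | inj₂ va≈1 = begin
      v a * y a  ≈⟨ v*-≈1 {y} a va≈1 ⟩
      y a        ≤⟨ 𝒬-≤1 y∈𝒬 a ⟩
      1#         ≈⟨ va≈1 ⟨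
      v a        ≈⟨ v*-≈1 {v} a va≈1 ⟨
      v a * v a  ∎

    module _ {y} (y∈𝒬 : 𝒬 y) (φy≈φv : φ y ≈ φ v) where

      vy≈vv : ∀ a → v a * y a ≈ v a * v a
      -- Termwise equality is known for indices in `Fin n`; the bijection carries it back to `a`.
      vy≈vv a = ≡.subst (λ b → v b * y b ≈ v b * v b) (strictlyInverseʳ a)
        (≤∧sum≈⇒≈ (vy≤vv y∈𝒬 ∘ from) φy≈φv (to a))

      ≈1 : ∀ a → v a ≈ 1# → y a ≈ v a
      ≈1 a va≈1 = trans (sym (v*-≈1 {y} a va≈1)) (trans (vy≈vv a) (v*-≈1 {v} a va≈1))

      maximal : y ≋ v
      maximal a with zeroOne a
      ... | inj₂ va≈1 = ≈1 a va≈1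
      ... | inj₁ va≈0 = +-cancelʳ-≈ (v (flip a)) (begin-equality
        y a + v (flip a)  ≈⟨ +-congˡ (≈1 (flip a) (x+y≈1∧x≈0⇒y≈1 (𝒬-flip v∈𝒬 a) va≈0)) ⟨
        y a + y (flip a)  ≈⟨ 𝒬-flip y∈𝒬 a ⟩
        1#                ≈⟨ 𝒬-flip v∈𝒬 a ⟨
        v a + v (flip a)  ∎)

  -- The function `nu`, and consequences of a decidable order.

  module _ (_⊑?_ : Decidable _⊑_) where

    nu : ProbabilityFunction
    nu = fromʳ record
      { μ       = λ x y _ → μ x y
      ; 0≤μ     = λ {x} {y} _ → 0≤μ x y
      ; ⊑⇒μ≈1   = λ {x} {y} _ → ⊑⇒μ≈1 x y
      ; μ+μ≈1   = λ {x} {y} x≢y _ → μ+μ≈1 x y x≢y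
      ; μ-monoʳ = λ {x} {y} {z} _ _ → mono x y z
      }
      where
      μ : P → P → Carrier
      μ x y with x ⊑? y | y ⊑? x
      ... | yes _ | _     = 1#
      ... | no _  | yes _ = 0#
      ... | no _  | no _  = ½

      0≤μ : ∀ x y → 0# ≤ μ x y
      0≤μ x y with x ⊑? y | y ⊑? x
      ... | yes _ | _     = 0≤1
      ... | no _  | yes _ = ≤-refl
      ... | no _  | no _  = 0≤½

      μ≤1 : ∀ x y → μ x y ≤ 1#
      μ≤1 x y with x ⊑? y | y ⊑? x
      ... | yes _ | _     = ≤-refl
      ... | no _  | yes _ = 0≤1
      ... | no _  | no _  = ½≤1

      ⊑⇒μ≈1 : ∀ x y → x ⊑ y → μ x y ≈ 1#
      ⊑⇒μ≈1 x y x⊑y with x ⊑? y | y ⊑? x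
      ... | yes _ | _      = refl
      ... | no x⋢y | yes _ = contradiction x⊑y x⋢y
      ... | no x⋢y | no _  = contradiction x⊑y x⋢y

      μ+μ≈1 : ∀ x y → .(x ≢ y) → μ x y + μ y x ≈ 1#
      μ+μ≈1 x y x≢y with x ⊑? y | y ⊑? x
      ... | yes x⊑y | yes y⊑x = ⊥-elim-irr (x≢y (antisym x⊑y y⊑x))
      ... | yes _   | no _    = +-identityʳ 1#
      ... | no _    | yes _   = +-identityˡ 1#
      ... | no _    | no _    = ½+½≈1

      -- Passing from `y` up to `z` preserves `x ⊑ y`, and `z ⊑ x` entails `y ⊑ x`; hence the value
      -- can only move up through 0, ½, 1.
      mono : ∀ x y z → y ⊏ z → μ x y ≤ μ x z
      mono x y z (y⊑z , _) with x ⊑? z | z ⊑? x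
      ... | yes _   | _       = μ≤1 x y
      ... | no x⋢z  | z⊑x? with x ⊑? y | y ⊑? x
      ...   | yes x⊑y | _       = contradiction (⊑-trans x⊑y y⊑z) x⋢z
      mono x y z (y⊑z , _) | no x⋢z | yes z⊑x | no _ | yes _ = ≤-refl
      mono x y z (y⊑z , _) | no x⋢z | no _    | no _ | yes _ = 0≤½
      mono x y z (y⊑z , _) | no x⋢z | yes z⊑x | no _ | no y⋢x = contradiction (⊑-trans y⊑z z⊑x) y⋢x
      mono x y z (y⊑z , _) | no x⋢z | no _    | no _ | no _ = ≤-refl

    nu-restrict : restrict nu ≋ ½𝟏
    nu-restrict ((x , y) , [ x∥y ]) with x ⊑? y | y ⊑? x
    ... | yes x⊑y | _       = ⊥-elim-irr (proj₁ x∥y x⊑y)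
    ... | no _    | yes y⊑x = ⊥-elim-irr (proj₂ x∥y y⊑x)
    ... | no _    | no _    = refl

    nu-isNu : IsNu nu
    nu-isNu x y x≢y =
      (λ (x⊑y , _) → ⊑⇒π≈1 nu x≢y x⊑y) ,
      (λ x∥y → nu-restrict ((x , y) , [ x∥y ])) ,
      (λ (y⊑x , _) → ⊒⇒π≈0 nu x≢y y⊑x)

    -- Deciding `z ⊑ y` separates the case `y ≡ z`, so the inequality becomes available without a
    -- proof of `y ≢ z`.
    π-monoʳ-⊑ : ∀ ρ {x y z} .(x≢y : x ≢ y) .(x≢z : x ≢ z) → y ⊑ z →
                π ρ x y x≢y ≤ π ρ x z x≢z
    π-monoʳ-⊑ ρ {y = y} {z} x≢y x≢z y⊑z with z ⊑? y
    ... | no z⋢y  = π-monoʳ ρ x≢y x≢z (y⊑z , λ { ≡.refl → z⋢y y⊑z })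
    ... | yes z⊑y with ≡.refl ← antisym y⊑z z⊑y = ≤-refl

    𝒬-monoʳ : ∀ {v} → 𝒬 v → ∀ {x y z} (x∥y : x ∥ y) (x∥z : x ∥ z) → y ⊑ z →
              v ((x , y) , [ x∥y ]) ≤ v ((x , z) , [ x∥z ])
    𝒬-monoʳ (ρ , ρ≋v) x∥y x∥z y⊑z = ≤.≤-respˡ-≈ (ρ≋v (_ , [ x∥y ])) (≤.≤-respʳ-≈ (ρ≋v (_ , [ x∥z ]))
      (π-monoʳ-⊑ ρ (∥⇒≢ x∥y) (∥⇒≢ x∥z) y⊑z))

    𝒬-antiˡ : ∀ {v} → 𝒬 v → ∀ {x y z} (y∥x : y ∥ x) (z∥x : z ∥ x) → y ⊑ z →
              v ((z , x) , [ z∥x ]) ≤ v ((y , x) , [ y∥x ])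
    𝒬-antiˡ v∈𝒬 y∥x z∥x y⊑z = complement-anti
      (𝒬-flip v∈𝒬 (_ , [ swap y∥x ])) (𝒬-flip v∈𝒬 (_ , [ swap z∥x ]))
      (𝒬-monoʳ v∈𝒬 (swap y∥x) (swap z∥x) y⊑z)

    -- At comparable pairs the axioms force the value 1 or 0; only incomparable pairs leave freedom.
    restrict-injective : ∀ ρ σ → restrict ρ ≋ restrict σ → ρ ≈ₚ σ
    restrict-injective ρ σ ρ≋σ x y x≢y with x ⊑? y | y ⊑? x
    ... | yes x⊑y | _       = trans (⊑⇒π≈1 ρ x≢y x⊑y) (sym (⊑⇒π≈1 σ x≢y x⊑y))
    ... | no _    | yes y⊑x = trans (⊒⇒π≈0 ρ x≢y y⊑x) (sym (⊒⇒π≈0 σ x≢y y⊑x))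
    ... | no x⋢y  | no y⋢x  = ρ≋σ ((x , y) , [ x⋢y , y⋢x ])

    restrict-½𝟏⇔nu : ∀ ρ → restrict ρ ≋ ½𝟏 ⇔ ρ ≈ₚ nu
    restrict-½𝟏⇔nu ρ = mk⇔
      (λ ρ≋½ → restrict-injective ρ nu λ a → trans (ρ≋½ a) (sym (nu-restrict a)))
      (λ { ρ≈ν a@((x , y) , [ x∥y ]) → trans (ρ≈ν x y (∥⇒≢ x∥y)) (nu-restrict a) })

-- Finite enumerations.

private variable
  a p : Level
  A : Set a

lookup-injective : {xs : List A} → Unique xs → ∀ i j →
                   List.lookup xs i ≡ List.lookup xs j → i ≡ j
lookup-injective (x∉ ∷ u) zero    zero    eq = ≡.refl
lookup-injective (x∉ ∷ u) zero    (suc j) eq = contradiction eq (All.lookup x∉ (∈-lookup j))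
lookup-injective (x∉ ∷ u) (suc i) zero    eq = contradiction (≡.sym eq) (All.lookup x∉ (∈-lookup i))
lookup-injective (x∉ ∷ u) (suc i) (suc j) eq = ≡.cong suc (lookup-injective u i j eq)

-- Counting by evaluation: for a concrete `Q?` and list, the hypothesis on the length holds by
-- `refl`. As proofs in the refinement are irrelevant, an element is recovered from its value, and
-- its proof from `Q?`.
refinement↔Fin : {Q : Pred A p} (Q? : Decidable₁ Q) {xs : List A} → Unique xs → (∀ x → x ∈ xs) →
                 ∀ {n} → length (filter Q? xs) ≡ n → [ x ∈ A ∣ Q x ] ↔ Fin n
refinement↔Fin {A = A} {Q = Q} Q? {xs} unique complete ≡.refl = mk↔ₛ′ to from to∘from from∘to
  where
  member : (x : [ x ∈ A ∣ Q x ]) → value x ∈ filter Q? xs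
  member (x , [ q ]) = ∈-filter⁺ Q? (complete x) (recompute (Q? x) q)

  to : [ x ∈ A ∣ Q x ] → Fin (length (filter Q? xs))
  to = Any.index ∘ member

  from : Fin (length (filter Q? xs)) → [ x ∈ A ∣ Q x ]
  from i = List.lookup (filter Q? xs) i , [ proj₂ (∈-filter⁻ Q? {xs = xs} (∈-lookup i)) ]

  to∘from : ∀ i → to (from i) ≡ i
  to∘from i = lookup-injective (Unique.filter⁺ Q? unique) _ _
                (≡.sym (lookup-index (member (from i))))

  from∘to : ∀ x → from (to x) ≡ x
  from∘to x = value-injective (≡.sym (lookup-index (member x)))

vecs : List A → ∀ n → List (Vec A n)
vecs xs 0       = [] ∷ []
vecs xs (suc n) = cartesianProductWith _∷_ xs (vecs xs n)

vecs-unique : {xs : List A} → Unique xs → ∀ n → Unique (vecs xs n)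
vecs-unique u 0       = All.[] ∷ []
vecs-unique u (suc n) = Unique.cartesianProductWith⁺ _∷_ ∷-injective u (vecs-unique u n)

vecs-complete : {xs : List A} → (∀ x → x ∈ xs) → ∀ {n} (v : Vec A n) → v ∈ vecs xs n
vecs-complete c []      = here ≡.refl
vecs-complete c (x ∷ v) = ∈-cartesianProductWith⁺ _∷_ (c x) (vecs-complete c v)

-- Combinatorics of the cube.

module CubePoset where

  P : Set
  P = Fin 2 × Fin 2 × Fin 2

  ⊑-isPartialOrder = C₂ ×ᵖ C₂ ×ᵖ C₂

  open Incomparability ⊑-isPartialOrder using (_⊏_; _∥_; 𝒜)

  infix 4 _⊑_ _⊑?_ _≟_

  _⊑_ : P → P → Set
  _⊑_ = Pointwise Fin._≤_ (Pointwise Fin._≤_ Fin._≤_)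

  _⊑?_ : Decidable _⊑_
  _⊑?_ = ×-decidable Fin._≤?_ (×-decidable Fin._≤?_ Fin._≤?_)

  _≟_ : DecidableEquality P
  _≟_ = ×-≡-dec Fin._≟_ (×-≡-dec Fin._≟_ Fin._≟_)

  _∥?_ : Decidable _∥_
  x ∥? y = ¬? (x ⊑? y) ×-dec ¬? (y ⊑? x)

  -- Makes statements quantified over the cube decidable, so that `toWitness` can prove them by
  -- evaluation.
  ∀? : {Q : Pred P p} → Decidable₁ Q → Dec (∀ x → Q x)
  ∀? Q? = map′ (λ h (a , b , c) → h a b c) (λ h a b c → h (a , b , c))
            (Fin.all? λ a → Fin.all? λ b → Fin.all? λ c → Q? (a , b , c))

  elements : List P
  elements = cartesianProduct (allFin 2) (cartesianProduct (allFin 2) (allFin 2))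

  elements-unique : Unique elements
  elements-unique = Unique.cartesianProduct⁺ (Unique.allFin⁺ 2)
                      (Unique.cartesianProduct⁺ (Unique.allFin⁺ 2) (Unique.allFin⁺ 2))

  elements-complete : ∀ x → x ∈ elements
  elements-complete (a , b , c) =
    ∈-cartesianProduct⁺ (∈-allFin a) (∈-cartesianProduct⁺ (∈-allFin b) (∈-allFin c))

  abstract
    -- Evaluation finds 18 incomparable pairs among the 64 ordered pairs.
    𝒜↔Fin18 : 𝒜 ↔ Fin 18
    𝒜↔Fin18 = refinement↔Fin (uncurry _∥?_)
      (Unique.cartesianProduct⁺ elements-unique elements-unique)
      (λ (x , y) → ∈-cartesianProduct⁺ (elements-complete x) (elements-complete y)) ≡.refl

  pattern e₀ = 1F , 0F , 0F
  pattern e₁ = 0F , 1F , 0F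
  pattern e₂ = 0F , 0F , 1F
  pattern ē₀ = 0F , 1F , 1F
  pattern ē₁ = 1F , 0F , 1F
  pattern ē₂ = 1F , 1F , 0F

  e ē : Fin 3 → P
  e 0F = e₀
  e 1F = e₁
  e 2F = e₂
  ē 0F = ē₀
  ē 1F = ē₁
  ē 2F = ē₂

  abstract
    e⋢ē : ∀ i → ¬ (e i ⊑ ē i)
    e⋢ē = toWitness {a? = Fin.all? λ i → ¬? (e i ⊑? ē i)} _

    ē⋢e : ∀ i → ¬ (ē i ⊑ e i)
    ē⋢e = toWitness {a? = Fin.all? λ i → ¬? (ē i ⊑? e i)} _

  e∥ē : ∀ i → e i ∥ ē i
  e∥ē i = e⋢ē i , ē⋢e i

  abstract
    e⊑ē : ∀ i j → i ≢ j → e i ⊑ ē j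
    e⊑ē = toWitness {a? = Fin.all? λ i → Fin.all? λ j → ¬? (i Fin.≟ j) →-dec e i ⊑? ē j} _

    e-∥ : ∀ i j → i ≢ j → e i ∥ e j
    e-∥ = toWitness {a? = Fin.all? λ i → Fin.all? λ j → ¬? (i Fin.≟ j) →-dec (e i ∥? e j)} _

    ē-∥ : ∀ i j → i ≢ j → ē i ∥ ē j
    ē-∥ = toWitness {a? = Fin.all? λ i → Fin.all? λ j → ¬? (i Fin.≟ j) →-dec (ē i ∥? ē j)} _

    -- The witness is a coordinate in which `x` is 1 and `y` is 0.
    separate : ∀ x y → ¬ (x ⊑ y) → ∃ λ i → e i ⊑ x × y ⊑ ē i
    separate = toWitness {a? = ∀? λ x → ∀? λ y → ¬? (x ⊑? y) →-dec
      Fin.any? λ i → (e i ⊑? x) ×-dec (y ⊑? ē i)} _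

  -- The position in the lexicographic order that compares coordinate i second.
  rank : Fin 3 → P → ℕ
  rank 0F (a , b , c) = 4 ℕ.* Fin.toℕ b ℕ.+ 2 ℕ.* Fin.toℕ a ℕ.+ Fin.toℕ c
  rank 1F (a , b , c) = 4 ℕ.* Fin.toℕ a ℕ.+ 2 ℕ.* Fin.toℕ b ℕ.+ Fin.toℕ c
  rank 2F (a , b , c) = 4 ℕ.* Fin.toℕ a ℕ.+ 2 ℕ.* Fin.toℕ c ℕ.+ Fin.toℕ b

  _≤[_]ᵇ_ : P → Fin 3 → P → Bool
  x ≤[ i ]ᵇ y = rank i x ≤ᵇ rank i y

  abstract
    ≤ᵇ-flip : ∀ i x y → x ≢ y → y ≤[ i ]ᵇ x ≡ not (x ≤[ i ]ᵇ y)
    ≤ᵇ-flip = toWitness {a? = Fin.all? λ i → ∀? λ x → ∀? λ y → ¬? (x ≟ y) →-dec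
      (y ≤[ i ]ᵇ x) Bool.≟ not (x ≤[ i ]ᵇ y)} _

    -- Lists when the comparison with `x` can change between `y` and `z`. If `x ⊑ z` or `y ⊑ x`, the
    -- constraint `π x y ≤ π x z` is vacuous; in the last two cases it has `π (ē i) (e i)` on the
    -- left or its complement on the right.
    ≤ᵇ-compat : ∀ i x y z → y ⊑ z →
      y ≤[ i ]ᵇ x ≡ z ≤[ i ]ᵇ x ⊎ x ⊑ z ⊎ y ⊑ x ⊎
      (x ≡ ē i × y ≡ e i) ⊎ (x ≡ e i × z ≡ ē i)
    ≤ᵇ-compat = toWitness {a? = Fin.all? λ i → ∀? λ x → ∀? λ y → ∀? λ z → (y ⊑? z) →-dec
      (((y ≤[ i ]ᵇ x) Bool.≟ (z ≤[ i ]ᵇ x)) ⊎-dec (x ⊑? z) ⊎-dec (y ⊑? x) ⊎-dec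
       ((x ≟ ē i) ×-dec (y ≟ e i)) ⊎-dec ((x ≟ e i) ×-dec (z ≟ ē i)))} _

  -- A 0/1 point is encoded by one bit for each unordered incomparable pair; a
  -- literal is the value at an ordered pair as a function of the nine bits.
  Literal : Set
  Literal = Bool ⊎ Bool × Fin 9

  pattern const b = inj₁ b
  pattern pos k = inj₂ (true , k)
  pattern neg k = inj₂ (false , k)

  _≟ˡ_ : DecidableEquality Literal
  _≟ˡ_ = ⊎-≡-dec Bool._≟_ (×-≡-dec Bool._≟_ Fin._≟_)

  complement : Literal → Literal
  complement (const b)      = const (not b)
  complement (inj₂ (s , k)) = inj₂ (not s , k)

  eval : Vec Bool 9 → Literal → Bool
  eval w (const b) = b
  eval w (pos k)   = Vec.lookup w k
  eval w (neg k)   = not (Vec.lookup w k)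

  eval-complement : ∀ w l → eval w (complement l) ≡ not (eval w l)
  eval-complement w (const b) = ≡.refl
  eval-complement w (pos k)   = ≡.refl
  eval-complement w (neg k)   = ≡.sym (Bool.not-involutive _)

  literal : P → P → Literal
  literal e₀ e₁ = pos 0F
  literal e₁ e₂ = pos 1F
  literal e₂ e₀ = pos 2F
  literal ē₀ ē₁ = pos 3F
  literal ē₁ ē₂ = pos 4F
  literal ē₂ ē₀ = pos 5F
  literal e₀ ē₀ = pos 6F
  literal e₁ ē₁ = pos 7F
  literal e₂ ē₂ = pos 8F
  literal e₁ e₀ = neg 0F
  literal e₂ e₁ = neg 1F
  literal e₀ e₂ = neg 2F
  literal ē₁ ē₀ = neg 3F
  literal ē₂ ē₁ = neg 4F
  literal ē₀ ē₂ = neg 5F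
  literal ē₀ e₀ = neg 6F
  literal ē₁ e₁ = neg 7F
  literal ē₂ e₂ = neg 8F
  -- Only comparable pairs, the diagonal included, reach this clause.
  literal x  y  = const (Dec.does (x ⊑? y))

  pairs : Vec (P × P) 9
  pairs = (e₀ , e₁) ∷ (e₁ , e₂) ∷ (e₂ , e₀) ∷ (ē₀ , ē₁) ∷ (ē₁ , ē₂) ∷ (ē₂ , ē₀) ∷
          (e₀ , ē₀) ∷ (e₁ , ē₁) ∷ (e₂ , ē₂) ∷ []

  pair : Fin 9 → P × P
  pair = Vec.lookup pairs

  abstract
    pair-∥ : ∀ k → uncurry _∥_ (pair k)
    pair-∥ = toWitness {a? = Fin.all? λ k → uncurry _∥?_ (pair k)} _

    literal-pair : ∀ k → uncurry literal (pair k) ≡ pos k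
    literal-pair = toWitness {a? = Fin.all? λ k → uncurry literal (pair k) ≟ˡ pos k} _

    literal-⊑ : ∀ x y → x ⊑ y → literal x y ≡ const true
    literal-⊑ = toWitness {a? = ∀? λ x → ∀? λ y → (x ⊑? y) →-dec (literal x y ≟ˡ const true)} _

    literal-flip : ∀ x y → x ≢ y → literal y x ≡ complement (literal x y)
    literal-flip = toWitness {a? = ∀? λ x → ∀? λ y → ¬? (x ≟ y) →-dec
      (literal y x ≟ˡ complement (literal x y))} _

    ∥⇒pair : ∀ x y → x ∥ y → ∃ λ k → pair k ≡ (x , y) ⊎ pair k ≡ (y , x)
    ∥⇒pair = toWitness {a? = ∀? λ x → ∀? λ y → (x ∥? y) →-dec Fin.any? λ k →
      ×-≡-dec _≟_ _≟_ (pair k) (x , y) ⊎-dec ×-≡-dec _≟_ _≟_ (pair k) (y , x)} _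

  -- The tables of bit vectors and their monotonicity constraints.

  table : Vec Bool 9 → P → P → Bool
  table w x y = eval w (literal x y)

  abstract
    -- Apart from trivial instances, monotonicity amounts to twelve inequalities, two for each
    -- ordered pair `i ≢ j`; these are the conditions collected in `Feasible`.
    critical : ∀ x y z → y ⊑ z → y ≡ z ⊎ x ⊑ z ⊎ y ⊑ x ⊎ ∃ λ i → ∃ λ j → i ≢ j ×
      ((x ≡ e i × y ≡ e j × z ≡ ē i) ⊎ (x ≡ ē i × y ≡ e i × z ≡ ē j))
    critical = toWitness {a? = ∀? λ x → ∀? λ y → ∀? λ z → (y ⊑? z) →-dec
      ((y ≟ z) ⊎-dec (x ⊑? z) ⊎-dec (y ⊑? x) ⊎-dec Fin.any? λ i → Fin.any? λ j → ¬? (i Fin.≟ j) ×-dec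
       (((x ≟ e i) ×-dec (y ≟ e j) ×-dec (z ≟ ē i)) ⊎-dec ((x ≟ ē i) ×-dec (y ≟ e i) ×-dec (z ≟ ē j))))} _

  table-⊑ : ∀ w {x y} → x ⊑ y → table w x y ≡ true
  table-⊑ w x⊑y = ≡.cong (eval w) (literal-⊑ _ _ x⊑y)

  table-flip : ∀ w {x y} → x ≢ y → table w y x ≡ not (table w x y)
  table-flip w {x} {y} x≢y =
    ≡.trans (≡.cong (eval w) (literal-flip x y x≢y)) (eval-complement w (literal x y))

  table-⊒ : ∀ w {x y} → x ≢ y → y ⊑ x → table w x y ≡ false
  table-⊒ w x≢y y⊑x = ≡.trans (table-flip w (≡.≢-sym x≢y)) (≡.cong not (table-⊑ w y⊑x))

  table-pair : ∀ w k → uncurry (table w) (pair k) ≡ Vec.lookup w k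
  table-pair w k = ≡.cong (eval w) (literal-pair k)

  Feasible : Pred (Vec Bool 9) _
  Feasible w = ∀ i j → i ≢ j →
    table w (e i) (e j) Bool.≤ table w (e i) (ē i) ×
    table w (ē i) (e i) Bool.≤ table w (ē i) (ē j)

  feasible? : Decidable₁ Feasible
  feasible? w = Fin.all? λ i → Fin.all? λ j → ¬? (i Fin.≟ j) →-dec
    (table w (e i) (e j) Bool.≤? table w (e i) (ē i)) ×-dec
    (table w (ē i) (e i) Bool.≤? table w (ē i) (ē j))

  bools : List Bool
  bools = true ∷ false ∷ []

  bools-unique : Unique bools
  bools-unique = ((λ ()) All.∷ All.[]) ∷ All.[] ∷ []

  bools-complete : ∀ b → b ∈ bools
  bools-complete true  = here ≡.refl
  bools-complete false = there (here ≡.refl)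

  abstract
    -- The count is obtained by filtering all 512 bit vectors.
    feasible↔Fin76 : [ w ∈ Vec Bool 9 ∣ Feasible w ] ↔ Fin 76
    feasible↔Fin76 = refinement↔Fin feasible? (vecs-unique bools-unique 9) (vecs-complete bools-complete) ≡.refl

-- The smallest coordinates of a point, and the vertex `½𝟏`.

module Cube {c ℓ₁ ℓ₂} (K : OrderedField c ℓ₁ ℓ₂) where
  open CubePoset
  open OrderedField K hiding (zero)
  open OrderedFieldProperties K
  open Probability K ⊑-isPartialOrder
  open ProbabilityProperties K ⊑-isPartialOrder
  open ProbabilityFunction using (π+π≈1; ⊑⇒π≈1)
  open Sum semiring using (sum; sum-cong-≋)
  open Solver commutativeSemiring using (solve; _:+_; _:=_)

  private module ⊑ = IsPartialOrder ⊑-isPartialOrder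

  low : Fin 3 → 𝒜
  low i = (ē i , e i) , [ swap (e∥ē i) ]

  -- Since `y ⋢ x`, some `i` satisfies `e i ⊑ y` and `x ⊑ ē i`. Lowering the second argument to
  -- `e i` and then raising the first to `ē i` can only decrease the value.
  low-minimal : ∀ {v} → 𝒬 v → ∀ a → ∃ λ i → v (low i) ≤ v a
  low-minimal {v} v∈𝒬 ((x , y) , [ irr-x∥y ]) =
    let x∥y = recompute (x ∥? y) irr-x∥y
        i , e⊑y , x⊑ē = separate y x (proj₂ x∥y)
        x∥e : x ∥ e i
        x∥e = (λ x⊑e → proj₁ x∥y (⊑.trans {x} {e i} {y} x⊑e e⊑y)) ,
              λ e⊑x → e⋢ē i (⊑.trans {e i} {x} {ē i} e⊑x x⊑ē)
    in i , (begin
      v (low i)                   ≤⟨ 𝒬-antiˡ _⊑?_ v∈𝒬 x∥e (swap (e∥ē i)) x⊑ē ⟩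
      v ((x , e i) , [ x∥e ])     ≤⟨ 𝒬-monoʳ _⊑?_ v∈𝒬 x∥e x∥y e⊑y ⟩
      v ((x , y) , [ x∥y ])       ∎)

  ½≤low⇒≋½𝟏 : ∀ {v} → 𝒬 v → (∀ i → ½ ≤ v (low i)) → v ≋ ½𝟏
  ½≤low⇒≋½𝟏 v∈𝒬 ½≤low = ½≤⇒≋½𝟏 v∈𝒬 λ a →
    let i , low≤ = low-minimal v∈𝒬 a in ≤.trans (½≤low i) low≤

  -- As `e j ⊑ ē i` and `e i ⊑ ē j`, the two values are bounded by those at `(e j , e i)` and
  -- `(e i , e j)`, which are complementary.
  low+low≤1 : ∀ {v} → 𝒬 v → ∀ i j → i ≢ j → v (low i) + v (low j) ≤ 1#
  low+low≤1 {v} v∈𝒬 i j i≢j = begin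
    v (low i) + v (low j)                                ≤⟨ +-mono-≤ (below j i (≡.≢-sym i≢j)) (below i j i≢j) ⟩
    v (atoms j i (≡.≢-sym i≢j)) + v (atoms i j i≢j)      ≈⟨ 𝒬-flip v∈𝒬 (atoms j i (≡.≢-sym i≢j)) ⟩
    1#                                                   ∎
    where
    atoms : ∀ i j → i ≢ j → 𝒜
    atoms i j i≢j = (e i , e j) , [ e-∥ i j i≢j ]

    below : ∀ i j (i≢j : i ≢ j) → v (low j) ≤ v (atoms i j i≢j)
    below i j i≢j = 𝒬-antiˡ _⊑?_ v∈𝒬 (e-∥ i j i≢j) (swap (e∥ē j)) (e⊑ē i j i≢j)

  module _ {x y z} (x+y≤1 : x + y ≤ 1#) (y+z≤1 : y + z ≤ 1#) (z+x≤1 : z + x ≤ 1#) where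

    -- Adding the three pairwise bounds counts every summand twice; then halve.
    x+y+z≤3/2 : x + (y + z) ≤ ½ + (½ + ½)
    x+y+z≤3/2 = x+x≤y+y⇒x≤y (begin
      x + (y + z) + (x + (y + z))            ≈⟨ rearrange x y z ⟩
      (x + y) + ((y + z) + (z + x))          ≤⟨ +-mono-≤ x+y≤1 (+-mono-≤ y+z≤1 z+x≤1) ⟩
      1# + (1# + 1#)                         ≈⟨ +-cong ½+½≈1 (+-cong ½+½≈1 ½+½≈1) ⟨
      (½ + ½) + ((½ + ½) + (½ + ½))          ≈⟨ rearrange ½ ½ ½ ⟨
      ½ + (½ + ½) + (½ + (½ + ½))            ∎)
      where
      rearrange : ∀ x y z → x + (y + z) + (x + (y + z)) ≈ (x + y) + ((y + z) + (z + x))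
      rearrange = solve 3 (λ x y z → x :+ (y :+ z) :+ (x :+ (y :+ z)) :=
                                     (x :+ y) :+ ((y :+ z) :+ (z :+ x))) refl

    ½≤x : x + (y + z) ≈ ½ + (½ + ½) → ½ ≤ x
    ½≤x eq = +-cancelʳ-≤ (½ + ½) (begin
      ½ + (½ + ½)  ≈⟨ eq ⟨
      x + (y + z)  ≤⟨ +-monoʳ-≤ x y+z≤1 ⟩
      x + 1#       ≈⟨ +-congˡ ½+½≈1 ⟨
      x + (½ + ½)  ∎)

  ½𝟏-vertex : IsVertex 𝒬 ½𝟏
  ½𝟏-vertex = φ , φ ½𝟏 , weightedSum-isLinear (λ _ → 1#) low ,
    (λ y y∈𝒬 → begin
      φ y                                              ≈⟨ φ-sum y ⟩
      y (low 0F) + (y (low 1F) + y (low 2F))           ≤⟨ x+y+z≤3/2 (0+1≤1 y∈𝒬) (1+2≤1 y∈𝒬) (2+0≤1 y∈𝒬) ⟩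
      ½ + (½ + ½)                                      ≈⟨ φ-sum ½𝟏 ⟨
      φ ½𝟏                                             ∎) ,
    λ y → mk⇔
      (λ y≋½𝟏 → (nu _⊑?_ , λ a → trans (nu-restrict _⊑?_ a) (sym (y≋½𝟏 a))) ,
                sum-cong-≋ λ i → *-congˡ {1#} (y≋½𝟏 (low i)))
      (λ (y∈𝒬 , φy≈φ½) → ½≤low⇒≋½𝟏 y∈𝒬 (½≤low y∈𝒬 (trans (sym (φ-sum y)) (trans φy≈φ½ (φ-sum ½𝟏)))))
    where
    φ : Point → Carrier
    φ y = sum λ i → 1# * y (low i)

    φ-sum : ∀ y → φ y ≈ y (low 0F) + (y (low 1F) + y (low 2F))
    φ-sum y = +-cong (*-identityˡ _) (+-cong (*-identityˡ _) (trans (+-identityʳ _) (*-identityˡ _)))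

    0+1≤1 : ∀ {y} → 𝒬 y → y (low 0F) + y (low 1F) ≤ 1#
    0+1≤1 y∈𝒬 = low+low≤1 y∈𝒬 0F 1F λ ()

    1+2≤1 : ∀ {y} → 𝒬 y → y (low 1F) + y (low 2F) ≤ 1#
    1+2≤1 y∈𝒬 = low+low≤1 y∈𝒬 1F 2F λ ()

    2+0≤1 : ∀ {y} → 𝒬 y → y (low 2F) + y (low 0F) ≤ 1#
    2+0≤1 y∈𝒬 = low+low≤1 y∈𝒬 2F 0F λ ()

    rotate : ∀ x y z → y + (z + x) ≈ x + (y + z)
    rotate = solve 3 (λ x y z → y :+ (z :+ x) := x :+ (y :+ z)) refl

    ½≤low : ∀ {y} → 𝒬 y → y (low 0F) + (y (low 1F) + y (low 2F)) ≈ ½ + (½ + ½) →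
            ∀ i → ½ ≤ y (low i)
    -- The three bounds are cyclically symmetric, so rotating the sum brings each coordinate to the
    -- front in turn.
    ½≤low q eq 0F = ½≤x (0+1≤1 q) (1+2≤1 q) (2+0≤1 q) eq
    ½≤low q eq 1F = ½≤x (1+2≤1 q) (2+0≤1 q) (0+1≤1 q) (trans (rotate _ _ _) eq)
    ½≤low q eq 2F = ½≤x (2+0≤1 q) (0+1≤1 q) (1+2≤1 q) (trans (sym (rotate _ _ _)) eq)

  -- Classification of the vertices.

  ½-thresholds : ∀ ρ → Thresholds ρ
  ½-thresholds ρ = record
    { θ = λ _ _ → ½ ; 0≤θ = λ _ _ → 0≤½ ; θ≤1 = λ _ _ → ½≤1
    ; θ+θ≈1 = λ _ → ½+½≈1 ; θ-const = λ _ _ _ → inj₁ refl }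

  lex-thresholds : ∀ ρ i → restrict ρ (low i) ≈ 0# → Thresholds ρ
  lex-thresholds ρ i low≈0 = record
    { θ       = θ
    ; 0≤θ     = λ x y → fromBool-0≤ (y ≤[ i ]ᵇ x)
    ; θ≤1     = λ x y → fromBool-≤1 (y ≤[ i ]ᵇ x)
    ; θ+θ≈1   = λ {x} {y} x≢y → trans
        (+-comm _ _)
        (≡.subst (λ b → θ y x + fromBool b ≈ 1#) (≡.sym (≤ᵇ-flip i x y (recompute (¬? (x ≟ y)) x≢y)))
          (fromBool-not (x ≤[ i ]ᵇ y)))
    ; θ-const = const′
    }
    where
    θ : P → P → Carrier
    θ x y = fromBool (y ≤[ i ]ᵇ x)

    const′ : ∀ {x y z} .(x≢y : x ≢ y) .(x≢z : x ≢ z) → y ⊏ z →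
             θ x y ≈ θ x z ⊎ π ρ x y x≢y ≈ 0# ⊎ π ρ x z x≢z ≈ 1#
    const′ {x} {y} {z} x≢y x≢z (y⊑z , _) with ≤ᵇ-compat i x y z y⊑z
    ... | inj₁ eq = inj₁ (reflexive (≡.cong fromBool eq))
    ... | inj₂ (inj₁ x⊑z) = inj₂ (inj₂ (⊑⇒π≈1 ρ x≢z x⊑z))
    ... | inj₂ (inj₂ (inj₁ y⊑x)) = inj₂ (inj₁ (⊒⇒π≈0 ρ x≢y y⊑x))
    -- In the two exceptional cases the hypothesis `low≈0` makes the constraint vacuous: its left
    -- side is 0, or its right side is the complement of 0.
    ... | inj₂ (inj₂ (inj₂ (inj₁ (≡.refl , ≡.refl)))) = inj₂ (inj₁ low≈0)
    ... | inj₂ (inj₂ (inj₂ (inj₂ (≡.refl , ≡.refl)))) = inj₂ (inj₂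
      (x+y≈1∧x≈0⇒y≈1 (π+π≈1 ρ (∥⇒≢ (swap (e∥ē i))) (∥⇒≢ (e∥ē i))) low≈0))

  vertex-cases : ∀ {v} → IsVertex 𝒬 v → ZeroOne v ⊎ v ≋ ½𝟏
  vertex-cases {v} vertex = cases (low-cases 0F) (low-cases 1F) (low-cases 2F)
    where
    v∈𝒬 : 𝒬 v
    v∈𝒬 = vertex∈ vertex

    ρ : ProbabilityFunction
    ρ = proj₁ v∈𝒬

    ρ≋v : restrict ρ ≋ v
    ρ≋v = proj₂ v∈𝒬

    low-cases : ∀ i → v (low i) ≈ 0# ⊎ ½ ≤ v (low i)
    -- By half-integrality the value is 0, 1 or `½`; the last two are merged.
    low-cases i = ⊎.map₂
      [ (λ ≈1 → ≤.≤-respʳ-≈ (sym ≈1) ½≤1) , ≤.reflexive ∘ sym ]′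
      (vertex-values (½-thresholds ρ) vertex ρ≋v (low i))

    zeroOne : ∀ i → v (low i) ≈ 0# → ZeroOne v
    -- The lexicographic threshold is itself 0 or 1, so all three possible values are.
    zeroOne i low≈0 a@((x , y) , _) = [ inj₁ ,
      [ inj₂ , (λ ≈θ → ⊎.map (trans ≈θ) (trans ≈θ) (fromBool-0or1 (y ≤[ i ]ᵇ x))) ]′ ]′
      (vertex-values (lex-thresholds ρ i (trans (ρ≋v (low i)) low≈0)) vertex ρ≋v a)

    cases : v (low 0F) ≈ 0# ⊎ ½ ≤ v (low 0F) → v (low 1F) ≈ 0# ⊎ ½ ≤ v (low 1F) →
            v (low 2F) ≈ 0# ⊎ ½ ≤ v (low 2F) → ZeroOne v ⊎ v ≋ ½𝟏
    cases (inj₁ ≈0) _         _         = inj₁ (zeroOne 0F ≈0)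
    cases (inj₂ _)  (inj₁ ≈0) _         = inj₁ (zeroOne 1F ≈0)
    cases (inj₂ _)  (inj₂ _)  (inj₁ ≈0) = inj₁ (zeroOne 2F ≈0)
    cases (inj₂ p)  (inj₂ q)  (inj₂ r)  =
      inj₂ (½≤low⇒≋½𝟏 v∈𝒬 λ { 0F → p ; 1F → q ; 2F → r })

  ½𝟏-not-zeroOne : ¬ ZeroOne ½𝟏
  ½𝟏-not-zeroOne zeroOne = [ ½≉0 , ½≉1 ]′ (zeroOne (low 0F))

  ½𝟏-not-integral : ¬ Integral ½𝟏
  ½𝟏-not-integral integral = uncurry ½-nonInteger (integral (low 0F))

  -- 0/1 points as feasible bit vectors.

  pairᴬ : Fin 9 → 𝒜
  pairᴬ k = pair k , [ pair-∥ k ]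

  point : Vec Bool 9 → Point
  point w ((x , y) , _) = fromBool (table w x y)

  point-zeroOne : ∀ w → ZeroOne (point w)
  point-zeroOne w ((x , y) , _) = fromBool-0or1 (table w x y)

  point-flip : ∀ w a → point w a + point w (flip a) ≈ 1#
  point-flip w ((x , y) , [ x∥y ]) =
    ≡.subst (λ b → fromBool (table w x y) + fromBool b ≈ 1#)
      (≡.sym (table-flip w (recompute (¬? (x ≟ y)) (∥⇒≢ x∥y)))) (fromBool-not (table w x y))

  point∈𝒬 : ∀ w → Feasible w → 𝒬 (point w)
  point∈𝒬 w feasible = fromʳ record
    { μ       = λ x y _ → fromBool (table w x y)
    ; 0≤μ     = λ {x} {y} _ → fromBool-0≤ (table w x y)
    ; ⊑⇒μ≈1   = λ _ x⊑y → reflexive (≡.cong fromBool (table-⊑ w x⊑y))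
    ; μ+μ≈1   = λ {x} {y} x≢y _ → ≡.subst (λ b → fromBool (table w x y) + fromBool b ≈ 1#)
        (≡.sym (table-flip w (recompute (¬? (x ≟ y)) x≢y))) (fromBool-not (table w x y))
    ; μ-monoʳ = λ {x} {y} {z} x≢y _ y⊏z → fromBool-mono-≤ (mono x y z x≢y y⊏z)
    } , λ _ → refl
    where
    mono : ∀ x y z → .(x ≢ y) → y ⊏ z → table w x y Bool.≤ table w x z
    mono x y z x≢y (y⊑z , y≢z) with critical x y z y⊑z
    ... | inj₁ y≡z = contradiction y≡z y≢z
    ... | inj₂ (inj₁ x⊑z) = ≡.subst (table w x y Bool.≤_) (≡.sym (table-⊑ w x⊑z)) (Bool.≤-maximum _)
    ... | inj₂ (inj₂ (inj₁ y⊑x)) = ≡.subst (Bool._≤ table w x z)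
      (≡.sym (table-⊒ w (recompute (¬? (x ≟ y)) x≢y) y⊑x)) (Bool.≤-minimum _)
    ... | inj₂ (inj₂ (inj₂ (i , j , i≢j , inj₁ (≡.refl , ≡.refl , ≡.refl)))) = proj₁ (feasible i j i≢j)
    ... | inj₂ (inj₂ (inj₂ (i , j , i≢j , inj₂ (≡.refl , ≡.refl , ≡.refl)))) = proj₂ (feasible i j i≢j)

  -- Every bit can be read off as the coordinate at its own pair.
  point-injective : ∀ w w′ → point w ≋ point w′ → w ≡ w′
  point-injective w w′ eq = ≡.trans (≡.sym (tabulate∘lookup w))
    (≡.trans (tabulate-cong lookup≡) (tabulate∘lookup w′))
    where
    lookup≡ : ∀ k → Vec.lookup w k ≡ Vec.lookup w′ k
    lookup≡ k = ≡.trans (≡.sym (table-pair w k)) (≡.trans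
      (fromBool-injective _ _ (eq (pairᴬ k))) (table-pair w′ k))

  module _ {v} (v∈𝒬 : 𝒬 v) (zeroOne : ZeroOne v) where

    bit : 𝒜 → Bool
    bit a = proj₁ (0or1⇒fromBool (zeroOne a))

    code : Vec Bool 9
    code = Vec.tabulate (bit ∘ pairᴬ)

    at-pair : ∀ k → point code (pairᴬ k) ≈ v (pairᴬ k)
    at-pair k = trans
      (reflexive (≡.cong fromBool (≡.trans (table-pair code k) (lookup∘tabulate (bit ∘ pairᴬ) k))))
      (proj₂ (0or1⇒fromBool (zeroOne (pairᴬ k))))

    -- Each incomparable pair is one of the nine chosen pairs or the reverse of one; reversed pairs
    -- follow by complementation, valid for both points.
    point-code : point code ≋ v
    point-code a@((x , y) , [ x∥y ]) with ∥⇒pair x y (recompute (x ∥? y) x∥y)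
    ... | k , inj₁ eq = ≡.subst (λ a → point code a ≈ v a) (value-injective eq) (at-pair k)
    ... | k , inj₂ eq = +-cancelʳ-≈ (point code (flip a)) (begin-equality
      point code a + point code (flip a)  ≈⟨ point-flip code a ⟩
      1#                                  ≈⟨ 𝒬-flip v∈𝒬 a ⟨
      v a + v (flip a)                    ≈⟨ +-congˡ (≡.subst (λ a → point code a ≈ v a) (value-injective eq) (at-pair k)) ⟨
      v a + point code (flip a)           ∎)

    code-feasible : Feasible code
    code-feasible i j i≢j =
      mono (e-∥ i j i≢j) (e∥ē i) (e⊑ē j i (≡.≢-sym i≢j)) ,
      mono (swap (e∥ē i)) (ē-∥ i j i≢j) (e⊑ē i j i≢j)
      where
      mono : ∀ {x y z} → x ∥ y → x ∥ z → y ⊑ z → table code x y Bool.≤ table code x z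
      mono {x} {y} {z} x∥y x∥z y⊑z = fromBool-cancel-≤ _ _ (begin
        fromBool (table code x y)   ≈⟨ point-code ((x , y) , [ x∥y ]) ⟩
        v ((x , y) , [ x∥y ])       ≤⟨ 𝒬-monoʳ _⊑?_ v∈𝒬 x∥y x∥z y⊑z ⟩
        v ((x , z) , [ x∥z ])       ≈⟨ point-code ((x , z) , [ x∥z ]) ⟨
        fromBool (table code x z)   ∎)

  feasible-value : (w : [ w ∈ Vec Bool 9 ∣ Feasible w ]) → Feasible (value w)
  feasible-value (w , [ feasible ]) = recompute (feasible? w) feasible

  -- Enumeration of the 77 vertices.

  open Inverse feasible↔Fin76 using (to; from; strictlyInverseˡ; strictlyInverseʳ)

  -- Index `zero` is reserved for the fractional vertex; the 76 feasible bit vectors are shifted by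
  -- one.
  vertex : Fin 77 → ∃ (IsVertex 𝒬)
  vertex zero    = ½𝟏 , ½𝟏-vertex
  vertex (suc i) = point w , zeroOne⇒vertex 𝒜↔Fin18 (point∈𝒬 w feasible) (point-zeroOne w)
    where
    w = value (from i)
    feasible : Feasible w
    feasible = feasible-value (from i)

  vertex-injective : ∀ i j → proj₁ (vertex i) ≋ proj₁ (vertex j) → i ≡ j
  vertex-injective zero    zero    _  = ≡.refl
  -- A coincidence with a 0/1 point would make `½𝟏` a 0/1 point.
  vertex-injective zero    (suc j) eq = contradiction
    (λ a → [ inj₁ ∘ trans (eq a) , inj₂ ∘ trans (eq a) ]′ (point-zeroOne _ a)) ½𝟏-not-zeroOne
  vertex-injective (suc i) zero    eq = contradiction
    (λ a → [ inj₁ ∘ trans (sym (eq a)) , inj₂ ∘ trans (sym (eq a)) ]′ (point-zeroOne _ a)) ½𝟏-not-zeroOne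
  vertex-injective (suc i) (suc j) eq = ≡.cong suc (≡.trans (≡.sym (strictlyInverseˡ i))
    (≡.trans (≡.cong to (value-injective (point-injective _ _ eq))) (strictlyInverseˡ j)))

  vertex-surjective : ∀ {v} → IsVertex 𝒬 v → ∃ λ i → proj₁ (vertex i) ≋ v
  vertex-surjective {v} isVertex =
    [ zeroOne-case , (λ v≋½𝟏 → zero , λ a → sym (v≋½𝟏 a)) ]′ (vertex-cases isVertex)
    where
    v∈𝒬 : 𝒬 v
    v∈𝒬 = vertex∈ isVertex

    zeroOne-case : ZeroOne v → ∃ λ i → proj₁ (vertex i) ≋ v
    zeroOne-case zeroOne = suc (to w) , λ a → trans
      (reflexive (≡.cong (λ w → point (value w) a) (strictlyInverseʳ w))) (point-code v∈𝒬 zeroOne a)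
      where
      w : [ w ∈ Vec Bool 9 ∣ Feasible w ]
      w = code v∈𝒬 zeroOne , [ code-feasible v∈𝒬 zeroOne ]

  vertex-cong : ∀ {i j} → i ≡ j → proj₁ (vertex i) ≋ proj₁ (vertex j)
  vertex-cong {i} i≡j a = reflexive (≡.cong (λ j → proj₁ (vertex j) a) i≡j)

  vertices : Bijection (≡.setoid (Fin 77)) (vertexSetoid 𝒬)
  vertices = record
    { to        = vertex
    ; cong      = vertex-cong
    ; bijective = (λ {i} {j} → vertex-injective i j) , λ (v , isVertex) →
        proj₁ (vertex-surjective isVertex) ,
        λ j≡i a → trans (vertex-cong j≡i a) (proj₂ (vertex-surjective isVertex) a)
    }

mainTheorem3 : {c ℓ₁ ℓ₂ : Level} (K : OrderedField c ℓ₁ ℓ₂) →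
    let open Probability K (C₂ ×ᵖ C₂ ×ᵖ C₂) in
    (𝒜 ↔ Fin 18)
    × Bijection (setoid (Fin 77)) (vertexSetoid 𝒬)
    × IsVertex 𝒬 ½𝟏
    × ¬ ZeroOne ½𝟏
    × (∀ v → IsVertex 𝒬 v → ¬ ZeroOne v → v ≋ ½𝟏)
    × (Σ[ ν ∈ ProbabilityFunction ] IsNu ν × (∀ ρ → restrict ρ ≋ ½𝟏 ⇔ ρ ≈ₚ ν))
    × ¬ IsZeroOnePolytope 𝒬
    × ¬ IsLatticePolytope 𝒬
mainTheorem3 K =
  𝒜↔Fin18 ,
  vertices ,
  ½𝟏-vertex ,
  ½𝟏-not-zeroOne ,
  (λ v isVertex ¬zeroOne → [ (λ zeroOne → contradiction zeroOne ¬zeroOne) , id ]′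
                             (vertex-cases isVertex)) ,
  (nu _⊑?_ , nu-isNu _⊑?_ , restrict-½𝟏⇔nu _⊑?_) ,
  (λ zeroOne → ½𝟏-not-zeroOne (zeroOne _ ½𝟏-vertex)) ,
  (λ lattice → ½𝟏-not-integral (lattice _ ½𝟏-vertex))
  where
  open Cube K
  open CubePoset using (𝒜↔Fin18; _⊑?_; ⊑-isPartialOrder)
  open ProbabilityProperties K ⊑-isPartialOrder
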